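{- Let $n\ge 3$ and $\varphi$ a linear functional with $\varphi(e_i)=a_i$, $0<a_1<\dots<a_n$. Every $\varphi$-monotone path on $\diamond^n$ is at distance at most $n-2$ in the flip graph from some coherent monotone path, and this bound is attained (e.g. by the path with vertices $-e_n,-e_{n-1},\dots,-e_1,e_2,\dots,e_{n-1},e_n$).
   Context: $\diamond^n=\mathrm{conv}\{\pm e_1,\dots,\pm e_n\}$. A monotone path is a sequence of vertices $-e_n=v_0,\dots,v_m=e_n$ with $v_{j-1}\neq -v_j$ and $\varphi(v_{j-1})<\varphi(v_j)$. The flip graph has the monotone paths as vertices, two being adjacent when one is obtained from the other by inserting or deleting a single vertex. A monotone path is coherent if there is a linear functional $\psi$ such that for $\pi=(\varphi,\psi):\mathbb{R}^n\to\mathbb{R}^2$ the images $\pi(v_0),\dots,\pi(v_m)$ are exactly the lower vertices of the polygon $\pi(\diamond^n)$ in order and each edge $[v_{j-1},v_j]$ is the preimage in $\diamond^n$ of a lower edge; for $\diamond^n$ this holds exactly when the path contains no antipodal pair other than $\{ -e_n,e_n\}$. -}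

module Defs where

open import Level using (Level; _⊔_) renaming (suc to lsuc)
open import Algebra.Bundles using (CommutativeRing)
open import Algebra.Module.Bundles using (module LeftModule)
open import Algebra.Module.Bundles.Raw using (RawLeftModule)
import Algebra.Module.Construct.TensorUnit as TensorUnit
open import Algebra.Module.Morphism.Structures using (module LeftModuleMorphisms)
open import Algebra.Definitions.RawMonoid using (sum)
open import Data.Bool.Base using (if_then_else_)
open import Data.Fin.Base using (Fin; fromℕ)
open import Data.Fin.Properties using (_≟_)
open import Data.List.Base using (List; map; reverse; allFin; drop; head; last; insertAt) renaming (_++_ to _++ᴸ_)
open import Data.List.Relation.Unary.Any using (Any)
open import Data.List.Relation.Unary.Linked using (Linked)
open import Data.Maybe.Base using (just)
open import Data.Nat.Base as ℕ using (ℕ; zero; suc; NonZero)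
open import Data.Product.Base using (Σ; ∃; ∃-syntax; _×_; _,_)
open import Data.Sign.Base as Sign using (Sign)
open import Data.Sum.Base using (_⊎_)
open import Data.Vec.Functional using (Vector; []; _∷_; _++_; zipWith; replicate) renaming (map to mapⱽ)
open import Function.Bundles using (_⇔_)
open import Relation.Binary.Core using (Rel)
import Relation.Binary.Construct.StrictToNonStrict as StrictToNonStrict
open import Relation.Binary.Construct.Closure.ReflexiveTransitive using (Star; ε; _◅_)
open import Relation.Binary.PropositionalEquality.Core using (_≡_; _≢_)
open import Relation.Binary.Structures using (IsStrictTotalOrder)
open import Relation.Nullary.Decidable.Core using (does)
open import Relation.Nullary.Negation.Core using (¬_)
open import Relation.Unary using (Pred)

-- The library has no real numbers; the scalars are an arbitrary (totally)
-- ordered field, of which ℝ is the intended instance.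
record OrderedField (c ℓ₁ ℓ₂ : Level) : Set (lsuc (c ⊔ ℓ₁ ⊔ ℓ₂)) where
  infix 4 _<_
  field
    commutativeRing : CommutativeRing c ℓ₁

  open CommutativeRing commutativeRing public

  field
    _<_                : Rel Carrier ℓ₂
    isStrictTotalOrder : IsStrictTotalOrder _≈_ _<_
    0<1                : 0# < 1#
    +-monoˡ-<          : ∀ {x y} z → x < y → x + z < y + z
    *-pos              : ∀ {x y} → 0# < x → 0# < y → 0# < x * y
    inverse            : ∀ {x} → ¬ x ≈ 0# → ∃[ y ] x * y ≈ 1#

  open StrictToNonStrict _≈_ _<_ public using (_≤_)

-- The vertex sᵢeᵢ of the cross-polytope is encoded as the pair (sᵢ , i).
Vertex : ℕ → Set
Vertex n = Sign × Fin n

antipode : ∀ {n} → Vertex n → Vertex n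
antipode (s , i) = Sign.opposite s , i

-- Indices are 0-based, so eₙ is the basis vector of index n ∸ 1.
lastIndex : ∀ n → .{{_ : NonZero n}} → Fin n
lastIndex (suc n) = fromℕ n

-- -eₙ , … , -e₁ , e₂ , … , eₙ
extremalPath : ∀ n → List (Vertex n)
extremalPath n = map (Sign.- ,_) (reverse (allFin n)) ++ᴸ map (Sign.+ ,_) (drop 1 (allFin n))

walkLength : ∀ {a r} {A : Set a} {R : Rel A r} {x y} → Star R x y → ℕ
walkLength ε       = 0
walkLength (_ ◅ w) = suc (walkLength w)

module CrossPolytope {c ℓ₁ ℓ₂} (F : OrderedField c ℓ₁ ℓ₂) where
  open OrderedField F

  Point : ℕ → Set c
  Point n = Vector Carrier n

  pointModule : ℕ → RawLeftModule Carrier c ℓ₁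
  pointModule n = record
    { Carrierᴹ = Point n
    ; _≈ᴹ_     = λ x y → ∀ i → x i ≈ y i
    ; _+ᴹ_     = zipWith _+_
    ; _*ₗ_     = λ r → mapⱽ (r *_)
    ; 0ᴹ       = replicate n 0#
    ; -ᴹ_      = mapⱽ (λ x → - x)
    }

  open module PointModule {n} = RawLeftModule (pointModule n) public
    using (_≈ᴹ_; -ᴹ_)

  scalarModule : RawLeftModule Carrier c ℓ₁
  scalarModule = LeftModule.rawLeftModule (TensorUnit.leftModule {R = ring})

  record LinearFunctional (n : ℕ) : Set (c ⊔ ℓ₁) where
    open LeftModuleMorphisms (pointModule n) scalarModule
    field
      ⟦_⟧      : Point n → Carrier
      isLinear : IsLeftModuleHomomorphism ⟦_⟧

  open LinearFunctional public using (⟦_⟧)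

  e : ∀ {n} → Fin n → Point n
  e i j = if does (i ≟ j) then 1# else 0#

  vertexPoint : ∀ {n} → Vertex n → Point n
  vertexPoint (Sign.+ , i) = e i
  vertexPoint (Sign.- , i) = -ᴹ (e i)

  conv : ∀ {n k} → Vector (Point n) k → Pred (Point n) (c ⊔ ℓ₁ ⊔ ℓ₂)
  conv {n} {k} points x = ∃ λ (t : Vector Carrier k) →
    (∀ j → 0# ≤ t j) × sum +-rawMonoid t ≈ 1# ×
    (∀ i → x i ≈ sum +-rawMonoid (λ j → t j * points j i))

  ◇ : ∀ n → Pred (Point n) (c ⊔ ℓ₁ ⊔ ℓ₂)
  ◇ n = conv ((λ i → vertexPoint (Sign.+ , i)) ++ (λ i → vertexPoint (Sign.- , i)))

  segment : ∀ {n} → Vertex n → Vertex n → Pred (Point n) (c ⊔ ℓ₁ ⊔ ℓ₂)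
  segment v w = conv (vertexPoint v ∷ vertexPoint w ∷ [])

  Plane : Set c
  Plane = Carrier × Carrier

  infix 4 _≈₂_
  _≈₂_ : Rel Plane ℓ₁
  (x , y) ≈₂ (x′ , y′) = x ≈ x′ × y ≈ y′

  -- A face of a planar polygon is lower when it minimises a functional with
  -- positive second coordinate; after rescaling, this is (x , y) ↦ y - s x,
  -- where s is the slope of the supporting line.
  height : Carrier → Plane → Carrier
  height s (x , y) = y - s * x

  LowerFace : ∀ {ℓ} → Pred Plane ℓ → Carrier → Pred Plane (c ⊔ ℓ₁ ⊔ ℓ₂ ⊔ ℓ)
  LowerFace P s p = P p × (∀ q → P q → height s p ≤ height s q)

  LowerVertex : ∀ {ℓ} → Pred Plane ℓ → Pred Plane (c ⊔ ℓ₁ ⊔ ℓ₂ ⊔ ℓ)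
  LowerVertex P p = ∃[ s ] LowerFace P s p × (∀ q → LowerFace P s q → q ≈₂ p)

  -- The lower face of slope s is an edge.
  LowerEdge : ∀ {ℓ} → Pred Plane ℓ → Carrier → Set (c ⊔ ℓ₁ ⊔ ℓ₂ ⊔ ℓ)
  LowerEdge P s = ∃[ p ] ∃[ q ] LowerFace P s p × LowerFace P s q × ¬ p ≈₂ q

  module _ {n : ℕ} (φ : LinearFunctional n) where

    projection : LinearFunctional n → Point n → Plane
    projection ψ x = ⟦ φ ⟧ x , ⟦ ψ ⟧ x

    shadow : LinearFunctional n → Pred Plane (c ⊔ ℓ₁ ⊔ ℓ₂)
    shadow ψ p = ∃[ x ] ◇ n x × projection ψ x ≈₂ p

    Step : Rel (Vertex n) ℓ₂
    Step v w = v ≢ antipode w × ⟦ φ ⟧ (vertexPoint v) < ⟦ φ ⟧ (vertexPoint w)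

    module _ .{{_ : NonZero n}} where

      record MonotonePath (vs : List (Vertex n)) : Set ℓ₂ where
        field
          starts : head vs ≡ just (Sign.- , lastIndex n)
          ends   : last vs ≡ just (Sign.+ , lastIndex n)
          steps  : Linked Step vs

      -- The left-to-right order of the lower vertices is the order of
      -- increasing φ, which is already imposed by monotonicity.
      record Coherent (vs : List (Vertex n)) : Set (c ⊔ ℓ₁ ⊔ ℓ₂) where
        field
          monotone      : MonotonePath vs
          ψ             : LinearFunctional n
          lowerVertices : ∀ p → LowerVertex (shadow ψ) p ⇔
                                Any (λ v → projection ψ (vertexPoint v) ≈₂ p) vs
          lowerEdges    : Linked (λ v w → ∃[ s ] LowerEdge (shadow ψ) s ×
                            (∀ x → segment v w x ⇔
                                   (◇ n x × LowerFace (shadow ψ) s (projection ψ x)))) vs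

      Insertion : Rel (List (Vertex n)) _
      Insertion vs ws = ∃[ i ] ∃[ v ] ws ≡ insertAt vs i v

      Flip : Rel (List (Vertex n)) ℓ₂
      Flip vs ws = MonotonePath vs × MonotonePath ws ×
                   (Insertion vs ws ⊎ Insertion ws vs)

      Walk : Rel (List (Vertex n)) ℓ₂
      Walk = Star Flip

      -- d is the least length of a walk from vs to a coherent path.
      DistanceToCoherent : List (Vertex n) → ℕ → Set (c ⊔ ℓ₁ ⊔ ℓ₂)
      DistanceToCoherent vs d =
        (∃[ ws ] Coherent ws × (Σ (Walk vs ws) λ w → walkLength w ≡ d)) ×
        (∀ ws → Coherent ws → (w : Walk vs ws) → d ℕ.≤ walkLength w)

{-# OPTIONS --safe #-}

-- Write x_v = φ(v), and call an index i paired on a path if both -eᵢ and eᵢ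
-- are vertices of it. A path is coherent iff n is its only paired index:
-- * the lower vertices of a centrally symmetric polygon contain no antipodal
--   pair but its two ends, by comparing the two supporting lines at the ends;
-- * conversely, ψ(v) = x_v² - x_{eₙ}² on the path and ψ(eᵢ) = 0 for the
--   indices i off the path turns the path into the lower hull of the shadow,
--   the secants of the parabola being the supporting lines.
-- The vertex p of least index on a monotone path has no antipode on the path,
-- as these would be consecutive, and p separates all antipodal pairs. Hence
-- one vertex of each pair can be removed, one at a time and without leaving
-- the monotone paths, so the distance to a coherent path is at most the number
-- of paired indices other than n, which is at most n - 2. A flip changes this
-- number by at most one, and it is n - 2 for the extremal path.
module Submission where

open import Defs
open import Algebra.Bundles using (RawRing)
open import Algebra.Module.Morphism.Structures using (module LeftModuleMorphisms)
import Algebra.Properties.AbelianGroup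
import Algebra.Properties.Ring
import Algebra.Properties.Semiring.Mult.TCOptimised
import Algebra.Properties.Semiring.Sum
import Algebra.Solver.Ring
open import Algebra.Solver.Ring.AlmostCommutativeRing using (fromCommutativeRing; _-Raw-AlmostCommutative⟶_)
open import Data.Fin.Base as Fin using (Fin; zero; suc; toℕ; fromℕ; fromℕ<; inject₁; _↑ˡ_; _↑ʳ_; splitAt)
import Data.Fin.Properties as Fin
open import Data.List.Base
  using (List; []; _∷_; _++_; map; reverse; allFin; tabulate; head; last; length; filter; insertAt)
open import Data.List.Extrema using (argmin; argmin-all; f[argmin]≤f[xs])
import Data.List.Membership.DecPropositional
open import Data.List.Membership.Propositional using (_∈_; _∉_; find; lose)
open import Data.List.Membership.Propositional.Properties
  using (∈-map⁺; ∈-map⁻; ∈-++⁺ˡ; ∈-++⁺ʳ; ∈-++⁻; ∈-tabulate⁺; ∈-tabulate⁻; ∈-allFin; ∈-filter⁺; ∈-filter⁻)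
import Data.List.Properties as List
open import Data.List.Relation.Unary.All as All using (All; []; _∷_)
import Data.List.Relation.Unary.All.Properties as All
open import Data.List.Relation.Unary.AllPairs using (AllPairs; []; _∷_)
import Data.List.Relation.Unary.AllPairs.Properties as AllPairs
open import Data.List.Relation.Unary.Any using (Any; here; there)
import Data.List.Relation.Unary.Any.Properties as Any
open import Data.List.Relation.Unary.Linked as Linked using (Linked; []; [-]; _∷_)
import Data.List.Relation.Unary.Linked.Properties as Linked
open import Data.List.Relation.Unary.Unique.Propositional using (Unique)
import Data.List.Relation.Unary.Unique.Propositional.Properties as Unique
open import Data.Maybe.Base using (Maybe; just; nothing)
open import Data.Nat.Base as ℕ using (ℕ; zero; suc; z≤n; s≤s; z<s; _∸_; NonZero)
import Data.Nat.Properties as ℕ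
open import Data.Product.Base using (Σ; ∃-syntax; _×_; _,_; proj₁; proj₂)
open import Data.Product.Properties using (≡-dec)
open import Data.Sign.Base as Sign using (Sign)
import Data.Sign.Properties as Sign
open import Data.Sum.Base using (_⊎_; inj₁; inj₂; [_,_]′)
open import Data.Vec.Functional using (Vector) renaming ([] to []ⱽ; _∷_ to _∷ⱽ_; _++_ to _++ⱽ_)
open import Function.Base using (_∘_; _$_; const; flip; id)
open import Function.Bundles using (_⇔_; mk⇔; module Equivalence)
open import Level using (_⊔_)
open import Relation.Binary.Bundles using (TotalOrder)
open import Relation.Binary.Construct.Closure.ReflexiveTransitive using (ε; _◅_)
import Relation.Binary.Construct.StrictToNonStrict as StrictToNonStrict
open import Relation.Binary.Core using (Rel)
open import Relation.Binary.Definitions using (tri<; tri≈; tri>)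
open import Relation.Binary.PropositionalEquality.Core as ≡ using (_≡_; _≢_)
import Relation.Binary.Reasoning.Setoid
open import Relation.Binary.Structures using (IsStrictTotalOrder)
open import Relation.Nullary using (¬_; Dec; yes; no; contradiction; ¬?; _×-dec_)
open import Relation.Nullary.Decidable using (dec-true; dec-false)

-- Ordered fields

module OrderedFieldProperties {c ℓ₁ ℓ₂} (F : OrderedField c ℓ₁ ℓ₂) where
  open OrderedField F hiding (zero)

  open Relation.Binary.Reasoning.Setoid setoid

  -- Ring solver with formal differences of naturals as coefficients:
  -- equality of these computes, unlike that of the abstract scalars.
  module Solver where
    open Algebra.Properties.Semiring.Mult.TCOptimised semiring
      using (×-homo-+; ×1-homo-*) renaming (_×_ to _·_)
    open Algebra.Properties.Ring ring using (-0#≈0#; -‿distribˡ-*; -‿distribʳ-*; -‿involutive)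
    open Algebra.Properties.AbelianGroup +-abelianGroup using () renaming (⁻¹-∙-comm to -‿+-comm)

    differences : RawRing _ _
    differences = record
      { Carrier = ℕ × ℕ
      ; _≈_     = _≡_
      ; _+_     = λ (a , b) (c , d) → a ℕ.+ c , b ℕ.+ d
      ; _*_     = λ (a , b) (c , d) → a ℕ.* c ℕ.+ b ℕ.* d , a ℕ.* d ℕ.+ b ℕ.* c
      ; -_      = λ (a , b) → b , a
      ; 0#      = 0 , 0
      ; 1#      = 1 , 0
      }

    value : ℕ × ℕ → Carrier
    value (a , b) = a · 1# - b · 1#

    +-interchange : ∀ w x y z → (w + x) + (y + z) ≈ (w + y) + (x + z)
    +-interchange w x y z = begin
      (w + x) + (y + z) ≈⟨ +-assoc w x _ ⟩
      w + (x + (y + z)) ≈⟨ +-congˡ (+-assoc x y z) ⟨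
      w + ((x + y) + z) ≈⟨ +-congˡ (+-congʳ (+-comm x y)) ⟩
      w + ((y + x) + z) ≈⟨ +-congˡ (+-assoc y x z) ⟩
      w + (y + (x + z)) ≈⟨ +-assoc w y _ ⟨
      (w + y) + (x + z) ∎

    difference-+ : ∀ w x y z → (w + x) - (y + z) ≈ (w - y) + (x - z)
    difference-+ w x y z = trans (+-congˡ (sym (-‿+-comm y z))) (+-interchange w x _ _)

    difference-* : ∀ w x y z → (w * y + x * z) - (w * z + x * y) ≈ (w - x) * (y - z)
    difference-* w x y z = begin
      (w * y + x * z) - (w * z + x * y)         ≈⟨ difference-+ _ _ _ _ ⟩
      (w * y - w * z) + (x * z - x * y)         ≈⟨ +-cong minusˡ minusʳ ⟩
      w * (y - z) + - x * (y - z)               ≈⟨ distribʳ _ _ _ ⟨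
      (w - x) * (y - z)                         ∎
      where
      minusˡ : w * y - w * z ≈ w * (y - z)
      minusˡ = trans (+-congˡ (-‿distribʳ-* w z)) (sym (distribˡ w y _))
      minusʳ : x * z - x * y ≈ - x * (y - z)
      minusʳ = begin
        x * z - x * y         ≈⟨ +-comm _ _ ⟩
        - (x * y) + x * z     ≈⟨ +-cong (-‿distribˡ-* x y) (sym (-‿involutive _)) ⟩
        - x * y - - (x * z)   ≈⟨ +-congˡ (-‿cong (-‿distribˡ-* x z)) ⟩
        - x * y - (- x * z)   ≈⟨ +-congˡ (-‿distribʳ-* (- x) z) ⟩
        - x * y + - x * - z   ≈⟨ distribˡ _ _ _ ⟨
        - x * (y - z)         ∎

    -- Formal differences represent the same integer when their cross sums agree, which is what
    -- `value≟` tests.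
    difference-cong : ∀ {w x y z} → w + z ≈ y + x → w - x ≈ y - z
    difference-cong {w} {x} {y} {z} eq = begin
      w - x                 ≈⟨ +-identityʳ _ ⟨
      (w - x) + 0#          ≈⟨ +-congˡ (-‿inverseʳ z) ⟨
      (w - x) + (z - z)     ≈⟨ +-interchange w (- x) z (- z) ⟩
      (w + z) + (- x - z)   ≈⟨ +-cong eq (+-comm _ _) ⟩
      (y + x) + (- z - x)   ≈⟨ +-interchange y x (- z) (- x) ⟩
      (y - z) + (x - x)     ≈⟨ +-congˡ (-‿inverseʳ x) ⟩
      (y - z) + 0#          ≈⟨ +-identityʳ _ ⟩
      y - z                 ∎

    homomorphism : differences -Raw-AlmostCommutative⟶ fromCommutativeRing commutativeRing
    homomorphism = record
      { ⟦_⟧    = value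
      ; +-homo = λ (a , b) (c , d) →
          trans (+-cong (×-homo-+ 1# a c) (-‿cong (×-homo-+ 1# b d))) (difference-+ _ _ _ _)
      ; *-homo = λ (a , b) (c , d) → trans
          (+-cong (products a c b d) (-‿cong (products a d b c)))
          (difference-* _ _ _ _)
      ; -‿homo = λ (a , b) → sym (begin
          - (a · 1# - b · 1#)     ≈⟨ -‿+-comm _ _ ⟨
          - (a · 1#) - - (b · 1#) ≈⟨ +-congˡ (-‿involutive _) ⟩
          - (a · 1#) + b · 1#     ≈⟨ +-comm _ _ ⟩
          b · 1# - a · 1#         ∎)
      ; 0-homo = -‿inverseʳ 0#
      ; 1-homo = trans (+-congˡ -0#≈0#) (+-identityʳ 1#)
      }
      where
      products : ∀ i j k l →
        (i ℕ.* j ℕ.+ k ℕ.* l) · 1# ≈ (i · 1#) * (j · 1#) + (k · 1#) * (l · 1#)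
      products i j k l = trans (×-homo-+ 1# (i ℕ.* j) (k ℕ.* l)) (+-cong (×1-homo-* i j) (×1-homo-* k l))

    value≟ : ∀ p q → Maybe (value p ≈ value q)
    value≟ (a , b) (c , d) with a ℕ.+ d ℕ.≟ c ℕ.+ b
    ... | no  _  = nothing
    ... | yes eq = just (difference-cong (begin
      a · 1# + d · 1#   ≈⟨ ×-homo-+ 1# a d ⟨
      (a ℕ.+ d) · 1#    ≡⟨ ≡.cong (_· 1#) eq ⟩
      (c ℕ.+ b) · 1#    ≈⟨ ×-homo-+ 1# c b ⟩
      c · 1# + b · 1#   ∎))

    open Algebra.Solver.Ring differences (fromCommutativeRing commutativeRing) homomorphism value≟ public
      using (solve; _:=_; _:+_; _:*_; _:-_; :-_)

  open Solver using (solve; _:=_; _:+_; _:*_; _:-_; :-_) public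

  open Algebra.Properties.Ring ring using (-0#≈0#) public
  open Algebra.Properties.Semiring.Sum semiring
    using (sum; sum-cong-≋; sum-replicate-zero; ∑-distrib-+; *-distribˡ-sum) public
  open IsStrictTotalOrder isStrictTotalOrder
    using (compare; <-respˡ-≈; <-respʳ-≈)
    renaming (irrefl to <-irrefl; trans to <-trans; asym to <-asym) public

  ≤-totalOrder : TotalOrder c ℓ₁ (ℓ₁ ⊔ ℓ₂)
  ≤-totalOrder = record { isTotalOrder = StrictToNonStrict.isTotalOrder _≈_ _<_ isStrictTotalOrder }

  open TotalOrder ≤-totalOrder public
    using (≤-respˡ-≈; ≤-respʳ-≈)
    renaming (refl to ≤-refl; trans to ≤-trans; antisym to ≤-antisym; total to ≤-total)

  <-≤-trans : ∀ {x y z} → x < y → y ≤ z → x < z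
  <-≤-trans = StrictToNonStrict.<-≤-trans _≈_ _<_ <-trans <-respʳ-≈

  ≤-<-trans : ∀ {x y z} → x ≤ y → y < z → x < z
  ≤-<-trans = StrictToNonStrict.≤-<-trans _≈_ _<_ sym <-trans <-respˡ-≈

  <⇒≱ : ∀ {x y} → x < y → ¬ y ≤ x
  <⇒≱ x<y y≤x = <-irrefl refl (<-≤-trans x<y y≤x)

  ≤∧≉⇒< : ∀ {x y} → x ≤ y → ¬ x ≈ y → x < y
  ≤∧≉⇒< (inj₁ x<y) _   = x<y
  ≤∧≉⇒< (inj₂ x≈y) x≉y = contradiction x≈y x≉y

  <⇒0<- : ∀ {x y} → x < y → 0# < y - x
  <⇒0<- {x} x<y = <-respˡ-≈ (-‿inverseʳ x) (+-monoˡ-< (- x) x<y)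

  ≤⇒0≤- : ∀ {x y} → x ≤ y → 0# ≤ y - x
  ≤⇒0≤- (inj₁ x<y) = inj₁ (<⇒0<- x<y)
  ≤⇒0≤- {x} (inj₂ x≈y) = inj₂ (trans (sym (-‿inverseʳ x)) (+-congʳ x≈y))

  ≤⇒-≤0 : ∀ {x y} → x ≤ y → x - y ≤ 0#
  ≤⇒-≤0 {x} {y} (inj₁ x<y) = inj₁ (<-respʳ-≈ (-‿inverseʳ y) (+-monoˡ-< (- y) x<y))
  ≤⇒-≤0 {x} {y} (inj₂ x≈y) = inj₂ (trans (+-congʳ x≈y) (-‿inverseʳ y))

  0<-⇒< : ∀ {x y d} → 0# < d → d ≈ y - x → x < y
  0<-⇒< {x} {y} 0<d d≈y-x =
    <-respˡ-≈ (+-identityˡ x) (<-respʳ-≈ cancel (+-monoˡ-< x (<-respʳ-≈ d≈y-x 0<d)))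
    where
    cancel : y - x + x ≈ y
    cancel = solve 2 (λ y x → y :- x :+ x := y) refl y x

  0≤-⇒≤ : ∀ {x y d} → 0# ≤ d → d ≈ y - x → x ≤ y
  0≤-⇒≤ (inj₁ 0<d) eq = inj₁ (0<-⇒< 0<d eq)
  0≤-⇒≤ {x} {y} (inj₂ 0≈d) eq = inj₂ (begin
    x            ≈⟨ +-identityˡ x ⟨
    0# + x       ≈⟨ +-congʳ (trans 0≈d eq) ⟩
    y - x + x    ≈⟨ solve 2 (λ y x → y :- x :+ x := y) refl y x ⟩
    y            ∎)

  +-mono-< : ∀ {w x y z} → w < x → y < z → w + y < x + z
  +-mono-< {w} {x} {y} {z} w<x y<z = <-trans (+-monoˡ-< y w<x)
    (<-respˡ-≈ (+-comm y x) (<-respʳ-≈ (+-comm z x) (+-monoˡ-< x y<z)))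

  +-pos : ∀ {x y} → 0# < x → 0# < y → 0# < x + y
  +-pos 0<x 0<y = <-respˡ-≈ (+-identityʳ 0#) (+-mono-< 0<x 0<y)

  +-nonneg-pos : ∀ {x y} → 0# ≤ x → 0# < y → 0# < x + y
  +-nonneg-pos (inj₁ 0<x) 0<y = +-pos 0<x 0<y
  +-nonneg-pos {x} {y} (inj₂ 0≈x) 0<y = <-respʳ-≈ (trans (sym (+-identityˡ y)) (+-congʳ 0≈x)) 0<y

  +-nonneg : ∀ {x y} → 0# ≤ x → 0# ≤ y → 0# ≤ x + y
  +-nonneg 0≤x (inj₁ 0<y) = inj₁ (+-nonneg-pos 0≤x 0<y)
  +-nonneg {x} 0≤x (inj₂ 0≈y) = ≤-respʳ-≈ (trans (sym (+-identityʳ x)) (+-congˡ 0≈y)) 0≤x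

  *-nonneg : ∀ {x y} → 0# ≤ x → 0# ≤ y → 0# ≤ x * y
  *-nonneg (inj₁ 0<x) (inj₁ 0<y) = inj₁ (*-pos 0<x 0<y)
  *-nonneg {x} {y} (inj₂ 0≈x) _  = inj₂ (trans (sym (zeroˡ y)) (*-congʳ 0≈x))
  *-nonneg {x} {y} _ (inj₂ 0≈y)  = inj₂ (trans (sym (zeroʳ x)) (*-congˡ 0≈y))

  neg-pos : ∀ {x} → x < 0# → 0# < - x
  neg-pos {x} x<0 = <-respʳ-≈ (+-identityˡ (- x)) (<⇒0<- x<0)

  neg-mono-< : ∀ {x y} → x < y → - y < - x
  neg-mono-< {x} {y} x<y =
    0<-⇒< (<⇒0<- x<y) (solve 2 (λ x y → y :- x := :- x :- :- y) refl x y)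

  neg-neg : ∀ {x} → 0# < x → - x < 0#
  neg-neg 0<x = <-respʳ-≈ -0#≈0# (neg-mono-< 0<x)

  zero-factor : ∀ {x y} → x * y ≈ 0# → 0# < y → x ≈ 0#
  zero-factor {x} {y} xy≈0 0<y with compare x 0#
  ... | tri< x<0 _ _ = contradiction
          (<-respʳ-≈ (trans (solve 2 (λ x y → :- x :* y := :- (x :* y)) refl x y) (trans (-‿cong xy≈0) -0#≈0#))
            (*-pos (neg-pos x<0) 0<y))
          (<-irrefl refl)
  ... | tri≈ _ x≈0 _ = x≈0
  ... | tri> _ _ 0<x = contradiction (<-respʳ-≈ xy≈0 (*-pos 0<x 0<y)) (<-irrefl refl)

  -- Finite sums and weighted averages

  sum-zero : ∀ {k} {f : Vector Carrier k} → (∀ j → f j ≈ 0#) → sum f ≈ 0#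
  sum-zero {k} f≈0 = trans (sum-cong-≋ f≈0) (sum-replicate-zero k)

  sum-single : ∀ {k} {f : Vector Carrier k} i → (∀ j → j ≢ i → f j ≈ 0#) → sum f ≈ f i
  sum-single zero    f≈0 = trans (+-congˡ (sum-zero λ j → f≈0 (suc j) λ ())) (+-identityʳ _)
  sum-single (suc i) f≈0 = trans
    (+-cong (f≈0 zero λ ()) (sum-single i λ j j≢i → f≈0 (suc j) (j≢i ∘ Fin.suc-injective)))
    (+-identityˡ _)

  sum-pair : ∀ {k} {f : Vector Carrier k} i j → i ≢ j →
             (∀ l → l ≢ i → l ≢ j → f l ≈ 0#) → sum f ≈ f i + f j
  sum-pair zero    zero    i≢j f≈0 = contradiction ≡.refl i≢j
  sum-pair zero    (suc j) i≢j f≈0 = +-congˡ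
    (sum-single j λ l l≢j → f≈0 (suc l) (λ ()) (l≢j ∘ Fin.suc-injective))
  sum-pair (suc i) zero    i≢j f≈0 = trans
    (+-congˡ (sum-single i λ l l≢i → f≈0 (suc l) (l≢i ∘ Fin.suc-injective) (λ ())))
    (+-comm _ _)
  sum-pair (suc i) (suc j) i≢j f≈0 = trans
    (+-cong (f≈0 zero (λ ()) (λ ()))
      (sum-pair i j (i≢j ∘ ≡.cong suc) λ l l≢i l≢j →
        f≈0 (suc l) (l≢i ∘ Fin.suc-injective) (l≢j ∘ Fin.suc-injective)))
    (+-identityˡ _)

  sum-nonneg : ∀ {k} {f : Vector Carrier k} → (∀ j → 0# ≤ f j) → 0# ≤ sum f
  sum-nonneg {zero}  0≤f = ≤-refl
  sum-nonneg {suc k} 0≤f = +-nonneg (0≤f zero) (sum-nonneg (0≤f ∘ suc))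

  sum-nonneg-zero : ∀ {k} {f : Vector Carrier k} → (∀ j → 0# ≤ f j) → sum f ≤ 0# → ∀ j → f j ≈ 0#
  sum-nonneg-zero {k = suc k} {f} 0≤f ∑f≤0 zero with 0≤f zero
  ... | inj₂ 0≈f₀ = sym 0≈f₀
  ... | inj₁ 0<f₀ = contradiction ∑f≤0
          (<⇒≱ (<-respʳ-≈ (+-comm _ _) (+-nonneg-pos (sum-nonneg (0≤f ∘ suc)) 0<f₀)))
  sum-nonneg-zero {k = suc k} {f} 0≤f ∑f≤0 (suc j) = sum-nonneg-zero (0≤f ∘ suc)
    (≤-trans (0≤-⇒≤ (0≤f zero) (solve 2 (λ x y → x := x :+ y :- y) refl (f zero) (sum (f ∘ suc)))) ∑f≤0) j

  module Weights {k} {t : Vector Carrier k} (0≤t : ∀ j → 0# ≤ t j) (∑t≈1 : sum t ≈ 1#) where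

    sum-deviation : ∀ (h : Vector Carrier k) m → sum (λ j → t j * (h j - m)) ≈ sum (λ j → t j * h j) - m
    sum-deviation h m = trans (go t h) (+-congˡ (-‿cong (trans (*-congʳ ∑t≈1) (*-identityˡ m))))
      where
      go : ∀ {k} (t h : Vector Carrier k) →
           sum (λ j → t j * (h j - m)) ≈ sum (λ j → t j * h j) - sum t * m
      go {zero}  t h = sym (trans (+-congˡ (trans (-‿cong (zeroˡ m)) -0#≈0#)) (+-identityʳ 0#))
      go {suc k} t h = trans (+-congˡ (go (t ∘ suc) (h ∘ suc)))
        (solve 5 (λ t₀ h₀ m th ∑t → t₀ :* (h₀ :- m) :+ (th :- ∑t :* m) := t₀ :* h₀ :+ th :- (t₀ :+ ∑t) :* m)
          refl _ _ _ _ _)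

    average-≥ : ∀ {h m} → (∀ j → m ≤ h j) → m ≤ sum (λ j → t j * h j)
    average-≥ {h} {m} m≤h = 0≤-⇒≤ (sum-nonneg λ j → *-nonneg (0≤t j) (≤⇒0≤- (m≤h j))) (sum-deviation h m)

    -- By `sum-deviation` the nonnegative terms `t j * (h j - m)` have a sum of at most 0, so each
    -- of them vanishes, and where `h j - m` is positive the weight must be 0.
    complementary-slackness : ∀ {h m} → (∀ j → m ≤ h j) → sum (λ j → t j * h j) ≤ m →
                              ∀ j → m < h j → t j ≈ 0#
    complementary-slackness {h} {m} m≤h ∑th≤m j m<hj = zero-factor
      (sum-nonneg-zero (λ j → *-nonneg (0≤t j) (≤⇒0≤- (m≤h j)))
        (≤-respˡ-≈ (sym (sum-deviation h m)) (≤⇒-≤0 ∑th≤m)) j)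
      (<⇒0<- m<hj)

  -- Opposite points of a centrally symmetric set cannot both be strictly
  -- lower, unless they are its leftmost and rightmost points (±A , ±Y).
  ¬antipodal-lower : ∀ {s s′ x y A Y} → - A < x → x < A →
    y - s * x < Y - s * A → y - s * x < - Y - s * - A →
    - y - s′ * - x < Y - s′ * A → ¬ - y - s′ * - x < - Y - s′ * - A
  -- Adding `h₁` and `h₄` eliminates `y` and `Y` and leaves 0 < (s′ - s)(A - x), which refutes s′ ≤
  -- s. Adding `h₂` and `h₃` leaves 0 < (s′ - s)(-A - x), which refutes s < s′.
  ¬antipodal-lower {s} {s′} {x} {y} {A} {Y} -A<x x<A h₁ h₂ h₃ h₄ with compare (s′ - s) 0#
  ... | tri< d<0 _ _ = <-irrefl refl (<-respʳ-≈ cancel (+-pos (*-pos (neg-pos d<0) (<⇒0<- x<A)) dx<dA))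
    where
    dx<dA : 0# < ((Y - s * A) + (- Y - s′ * - A)) - ((y - s * x) + (- y - s′ * - x))
    dx<dA = <⇒0<- (+-mono-< h₁ h₄)
    cancel : _ ≈ 0#
    cancel = trans (solve 6 (λ s s′ x y A Y →
        (:- (s′ :- s)) :* (A :- x) :+ (((Y :- s :* A) :+ (:- Y :- s′ :* :- A)) :- ((y :- s :* x) :+ (:- y :- s′ :* :- x)))
        := x :- x) refl s s′ x y A Y) (-‿inverseʳ x)
  ... | tri≈ _ d≈0 _ = <-irrefl refl (<-respʳ-≈ cancel dx<dA)
    where
    dx<dA : 0# < ((Y - s * A) + (- Y - s′ * - A)) - ((y - s * x) + (- y - s′ * - x))
    dx<dA = <⇒0<- (+-mono-< h₁ h₄)
    cancel : _ ≈ 0#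
    cancel = trans (solve 6 (λ s s′ x y A Y →
        ((Y :- s :* A) :+ (:- Y :- s′ :* :- A)) :- ((y :- s :* x) :+ (:- y :- s′ :* :- x))
        := (s′ :- s) :* (A :- x)) refl s s′ x y A Y) (trans (*-congʳ d≈0) (zeroˡ _))
  ... | tri> _ _ 0<d = <-irrefl refl (<-respʳ-≈ cancel (+-pos (*-pos 0<d (<⇒0<- -A<x)) dx<-dA))
    where
    dx<-dA : 0# < ((- Y - s * - A) + (Y - s′ * A)) - ((y - s * x) + (- y - s′ * - x))
    dx<-dA = <⇒0<- (+-mono-< h₂ h₃)
    cancel : _ ≈ 0#
    cancel = trans (solve 6 (λ s s′ x y A Y →
        (s′ :- s) :* (x :- :- A) :+ (((:- Y :- s :* :- A) :+ (Y :- s′ :* A)) :- ((y :- s :* x) :+ (:- y :- s′ :* :- x)))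
        := x :- x) refl s s′ x y A Y) (-‿inverseʳ x)

  -- The parabola and its supporting lines

  module Parabola (A : Carrier) where

    parabola : Carrier → Carrier
    parabola x = x * x - A * A

    -- The chord over `v` and `w` has slope v + w, and both sides equal -A² - vw. For v = w the
    -- chord becomes the tangent.
    secant-at-ends : ∀ v w → parabola v - (v + w) * v ≈ parabola w - (v + w) * w
    secant-at-ends v w = solve 3 (λ A v w →
      (v :* v :- A :* A) :- (v :+ w) :* v := (w :* w :- A :* A) :- (v :+ w) :* w) refl A v w

    -- The difference of the heights is (u - v)(u - w), which is positive outside the interval from
    -- `v` to `w`.
    secant-below-parabola : ∀ {u v w} → v ≤ w → u < v ⊎ w < u →
      parabola v - (v + w) * v < parabola u - (v + w) * u
    secant-below-parabola {u} {v} {w} v≤w outside = 0<-⇒< (positive outside)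
      (solve 4 (λ A u v w → (u :- v) :* (u :- w) :=
        ((u :* u :- A :* A) :- (v :+ w) :* u) :- ((v :* v :- A :* A) :- (v :+ w) :* v)) refl A u v w)
      where
      positive : u < v ⊎ w < u → 0# < (u - v) * (u - w)
      positive (inj₁ u<v) = <-respʳ-≈ (solve 3 (λ u v w → (v :- u) :* (w :- u) := (u :- v) :* (u :- w)) refl u v w)
        (*-pos (<⇒0<- u<v) (<⇒0<- (<-≤-trans u<v v≤w)))
      positive (inj₂ w<u) = *-pos (<⇒0<- (≤-<-trans v≤w w<u)) (<⇒0<- w<u)

    -- At A the secant has the value -(A - v)(A - w) and at -A the value -(A + v)(A + w), so at both
    -- ends it is at most 0. As its slope is not 0, it is negative strictly between them.
    secant-below-strip : ∀ {u v w y} → ¬ v + w ≈ 0# → - A ≤ v → v ≤ A → - A ≤ w → w ≤ A →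
      - A < u → u < A → 0# ≤ y → parabola v - (v + w) * v < y - (v + w) * u
    secant-below-strip {u} {v} {w} {y} v+w≉0 -A≤v v≤A -A≤w w≤A -A<u u<A 0≤y with compare (v + w) 0#
    ... | tri< s<0 _ _ = 0<-⇒<
            (+-nonneg-pos 0≤y (+-nonneg-pos (*-nonneg (≤⇒0≤- -A≤v) (≤⇒0≤- -A≤w)) (*-pos (neg-pos s<0) (<⇒0<- -A<u))))
            (solve 5 (λ A u v w y → y :+ ((v :- :- A) :* (w :- :- A) :+ (:- (v :+ w)) :* (u :- :- A)) :=
              (y :- (v :+ w) :* u) :- ((v :* v :- A :* A) :- (v :+ w) :* v)) refl A u v w y)
    ... | tri≈ _ s≈0 _ = contradiction s≈0 v+w≉0
    ... | tri> _ _ 0<s = 0<-⇒<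
            (+-nonneg-pos 0≤y (+-nonneg-pos (*-nonneg (≤⇒0≤- v≤A) (≤⇒0≤- w≤A)) (*-pos 0<s (<⇒0<- u<A))))
            (solve 5 (λ A u v w y → y :+ ((A :- v) :* (A :- w) :+ (v :+ w) :* (A :- u)) :=
              (y :- (v :+ w) :* u) :- ((v :* v :- A :* A) :- (v :+ w) :* v)) refl A u v w y)

    -- The ends of the arc are (A , 0) and (-A , 0). The right one is low enough if s ≥ 0, the left
    -- one if s ≤ 0.
    end-below-strip : ∀ {s u y} → - A < u → u < A → 0# ≤ y →
      parabola A - s * A ≤ y - s * u ⊎ parabola (- A) - s * - A ≤ y - s * u
    end-below-strip {s} {u} {y} -A<u u<A 0≤y with ≤-total 0# s
    ... | inj₁ 0≤s = inj₁ (0≤-⇒≤ (+-nonneg 0≤y (*-nonneg 0≤s (≤⇒0≤- (inj₁ u<A))))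
            (solve 4 (λ A s u y → y :+ s :* (A :- u) := (y :- s :* u) :- ((A :* A :- A :* A) :- s :* A)) refl A s u y))
    ... | inj₂ s≤0 = inj₂ (0≤-⇒≤ (+-nonneg 0≤y (*-nonneg (≤⇒0≤- s≤0) (≤⇒0≤- (inj₁ -A<u))))
            (trans (+-congˡ (*-congʳ (+-identityˡ (- s))))
              (solve 4 (λ A s u y → y :+ (:- s) :* (u :- :- A) :=
                (y :- s :* u) :- ((:- A :* :- A :- A :* A) :- s :* :- A)) refl A s u y)))

    parabola-≤0 : ∀ {x} → 0# < x → x ≤ A → parabola x ≤ 0#
    parabola-≤0 {x} 0<x x≤A = ≤⇒-≤0 (0≤-⇒≤
      (*-nonneg (≤⇒0≤- x≤A) (inj₁ (+-pos (<-≤-trans 0<x x≤A) 0<x)))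
      (solve 2 (λ A x → (A :- x) :* (A :+ x) := A :* A :- x :* x) refl A x))

-- Projections of the cross-polytope

infix 4 _≟ᵛ_
_≟ᵛ_ : ∀ {n} (v w : Vertex n) → Dec (v ≡ w)
_≟ᵛ_ = ≡-dec Sign._≟_ Fin._≟_

module CrossPolytopeProperties {c ℓ₁ ℓ₂} (F : OrderedField c ℓ₁ ℓ₂) where
  open OrderedField F hiding (zero)
  open CrossPolytope F
  open OrderedFieldProperties F
  open Relation.Binary.Reasoning.Setoid setoid

  module Linear {n} (f : LinearFunctional n) =
    LeftModuleMorphisms.IsLeftModuleHomomorphism {M₁ = pointModule n} {M₂ = scalarModule} (LinearFunctional.isLinear f)

  e-diagonal : ∀ {n} (i : Fin n) → e i i ≈ 1#
  e-diagonal i rewrite dec-true (i Fin.≟ i) ≡.refl = refl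

  e-off-diagonal : ∀ {n} {i j : Fin n} → j ≢ i → e i j ≈ 0#
  e-off-diagonal {i = i} {j} j≢i rewrite dec-false (i Fin.≟ j) (j≢i ∘ ≡.sym) = refl

  0≤e : ∀ {n} (i j : Fin n) → 0# ≤ e i j
  0≤e i j with j Fin.≟ i
  ... | yes ≡.refl = inj₁ (<-respʳ-≈ (sym (e-diagonal i)) 0<1)
  ... | no  j≢i    = inj₂ (sym (e-off-diagonal j≢i))

  functional : ∀ {n} → Vector Carrier n → LinearFunctional n
  functional {n} b = record
    { ⟦_⟧      = λ x → sum (λ i → x i * b i)
    ; isLinear = record
      { +ᴹ-isGroupHomomorphism = record
        { isMonoidHomomorphism = record
          { isMagmaHomomorphism = record
            { isRelHomomorphism = record { cong = λ x≈y → sum-cong-≋ λ i → *-congʳ (x≈y i) }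
            ; homo = λ x y → trans (sum-cong-≋ λ i → distribʳ (b i) (x i) (y i)) (∑-distrib-+ {n} _ _)
            }
          ; ε-homo = sum-zero λ i → zeroˡ (b i)
          }
        ; ⁻¹-homo = negate b
        }
      ; *ₗ-homo = λ r x → trans (sum-cong-≋ λ i → *-assoc r (x i) (b i)) (sym (*-distribˡ-sum {n} r _))
      }
    }
    where
    negate : ∀ {k} (b x : Vector Carrier k) → sum (λ i → - x i * b i) ≈ - sum (λ i → x i * b i)
    negate {zero}  b x = sym -0#≈0#
    negate {suc k} b x = trans (+-congˡ (negate (b ∘ suc) (x ∘ suc)))
      (solve 3 (λ x b s → :- x :* b :+ :- s := :- (x :* b :+ s)) refl _ _ _)

  functional-e : ∀ {n} (b : Vector Carrier n) i → ⟦ functional b ⟧ (e i) ≈ b i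
  functional-e b i = trans
    (sum-single i λ j j≢i → trans (*-congʳ (e-off-diagonal j≢i)) (zeroˡ (b j)))
    (trans (*-congʳ (e-diagonal i)) (*-identityˡ (b i)))

  -- Serves to rewrite a combination of two generators as one of all generators: with `b` constantly
  -- 1 it computes the total weight, with `b` a coordinate of the generators the resulting point.
  functional-pair : ∀ {n} (b : Vector Carrier n) r s i j →
    sum (λ k → (r * e i k + s * e j k) * b k) ≈ r * b i + s * b j
  functional-pair b r s i j = begin
    ⟦ f ⟧ (λ k → r * e i k + s * e j k)                   ≈⟨ Linear.+ᴹ-homo f _ _ ⟩
    ⟦ f ⟧ (λ k → r * e i k) + ⟦ f ⟧ (λ k → s * e j k)     ≈⟨ +-cong (Linear.*ₗ-homo f r (e i)) (Linear.*ₗ-homo f s (e j)) ⟩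
    r * ⟦ f ⟧ (e i) + s * ⟦ f ⟧ (e j)                     ≈⟨ +-cong (*-congˡ (functional-e b i)) (*-congˡ (functional-e b j)) ⟩
    r * b i + s * b j                                     ∎
    where f = functional b

  linear-sum : ∀ {n k} (f : LinearFunctional n) (t : Vector Carrier k) (p : Vector (Point n) k) →
    ⟦ f ⟧ (λ i → sum (λ j → t j * p j i)) ≈ sum (λ j → t j * ⟦ f ⟧ (p j))
  linear-sum {k = zero}  f t p = Linear.0ᴹ-homo f
  linear-sum {k = suc k} f t p = trans (Linear.+ᴹ-homo f _ _)
    (+-cong (Linear.*ₗ-homo f (t zero) (p zero)) (linear-sum f (t ∘ suc) (p ∘ suc)))

  linear-antipode : ∀ {n} (f : LinearFunctional n) v →
    ⟦ f ⟧ (vertexPoint (antipode v)) ≈ - ⟦ f ⟧ (vertexPoint v)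
  linear-antipode f (Sign.+ , i) = Linear.-ᴹ-homo f (e i)
  linear-antipode f (Sign.- , i) = begin
    ⟦ f ⟧ (e i)              ≈⟨ solve 1 (λ x → x := :- (:- x)) refl _ ⟩
    - (- ⟦ f ⟧ (e i))        ≈⟨ -‿cong (Linear.-ᴹ-homo f (e i)) ⟨
    - ⟦ f ⟧ (-ᴹ (e i))       ∎

  -- The vertices as generators of the cross-polytope

  module _ {n : ℕ} where
    generators : Vector (Point n) (n ℕ.+ n)
    generators = (λ i → vertexPoint (Sign.+ , i)) ++ⱽ (λ i → vertexPoint (Sign.- , i))

    vertexAt : Fin (n ℕ.+ n) → Vertex n
    vertexAt j = [ Sign.+ ,_ , Sign.- ,_ ]′ (splitAt n j)

    position : Vertex n → Fin (n ℕ.+ n)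
    position (Sign.+ , i) = i ↑ˡ n
    position (Sign.- , i) = n ↑ʳ i

    generators-vertexAt : ∀ j → generators j ≡ vertexPoint (vertexAt j)
    generators-vertexAt j with splitAt n j
    ... | inj₁ i = ≡.refl
    ... | inj₂ i = ≡.refl

    vertexAt-position : ∀ v → vertexAt (position v) ≡ v
    vertexAt-position (Sign.+ , i) rewrite Fin.splitAt-↑ˡ n i n = ≡.refl
    vertexAt-position (Sign.- , i) rewrite Fin.splitAt-↑ʳ n n i = ≡.refl

    position-vertexAt : ∀ j → position (vertexAt j) ≡ j
    position-vertexAt j with splitAt n j in eq
    ... | inj₁ i = Fin.splitAt⁻¹-↑ˡ eq
    ... | inj₂ i = Fin.splitAt⁻¹-↑ʳ eq

    generators-position : ∀ v → generators (position v) ≡ vertexPoint v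
    generators-position v = ≡.trans (generators-vertexAt (position v)) (≡.cong vertexPoint (vertexAt-position v))

    ≢position : ∀ {v j} → j ≢ position v → vertexAt j ≢ v
    ≢position j≢ eq = j≢ (≡.trans (≡.sym (position-vertexAt _)) (≡.cong position eq))

    position-injective : ∀ v w → position v ≡ position w → v ≡ w
    position-injective v w eq =
      ≡.trans (≡.sym (vertexAt-position v)) (≡.trans (≡.cong vertexAt eq) (vertexAt-position w))

    vertex∈◇ : ∀ v → ◇ n (vertexPoint v)
    -- The weights form a basis vector again, now of dimension n + n, so `functional-e` evaluates
    -- the combination.
    vertex∈◇ v = e (position v) , 0≤e (position v) ,
      trans (sum-single (position v) λ j → e-off-diagonal) (e-diagonal (position v)) ,
      λ i → trans (reflexive (≡.cong (_$ i) (≡.sym (generators-position v))))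
                  (sym (functional-e (λ j → generators j i) (position v)))

    segment⊆◇ : ∀ v w {x} → segment v w x → ◇ n x
    segment⊆◇ v w {x} (t , 0≤t , ∑t≈1 , x≈) =
      -- The two weights are moved to the positions of `v` and `w` by adding multiples of basis
      -- vectors, which also covers v = w.
      (λ k → t₀ * e i k + t₁ * e j k) ,
      (λ k → +-nonneg (*-nonneg (0≤t zero) (0≤e i k)) (*-nonneg (0≤t (suc zero)) (0≤e j k))) ,
      (begin
        sum (λ k → t₀ * e i k + t₁ * e j k)         ≈⟨ sum-cong-≋ {n ℕ.+ n} (λ k → *-identityʳ _) ⟨
        sum (λ k → (t₀ * e i k + t₁ * e j k) * 1#)  ≈⟨ functional-pair (const 1#) t₀ t₁ i j ⟩
        t₀ * 1# + t₁ * 1#                           ≈⟨ +-cong (*-identityʳ t₀) (trans (*-identityʳ t₁) (sym (+-identityʳ t₁))) ⟩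
        sum t                                       ≈⟨ ∑t≈1 ⟩
        1#                                          ∎) ,
      λ l → begin
        x l                                                        ≈⟨ x≈ l ⟩
        t₀ * vertexPoint v l + (t₁ * vertexPoint w l + 0#)         ≈⟨ +-congˡ (+-identityʳ _) ⟩
        t₀ * vertexPoint v l + t₁ * vertexPoint w l                ≡⟨ ≡.cong₂ (λ p q → t₀ * p l + t₁ * q l) (generators-position v) (generators-position w) ⟨
        t₀ * generators i l + t₁ * generators j l                  ≈⟨ functional-pair (λ k → generators k l) t₀ t₁ i j ⟨
        sum (λ k → (t₀ * e i k + t₁ * e j k) * generators k l)     ∎
      where
      t₀ = t zero
      t₁ = t (suc zero)
      i = position v
      j = position w

    -- Lower faces of the shadow

    module Projection (φ ψ : LinearFunctional n) where

      image : Vertex n → Plane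
      image v = projection φ ψ (vertexPoint v)

      height-cong : ∀ {s p q} → p ≈₂ q → height s p ≈ height s q
      height-cong (x≈ , y≈) = +-cong y≈ (-‿cong (*-congˡ x≈))

      projection-cong : ∀ {x y} → x ≈ᴹ y → projection φ ψ x ≈₂ projection φ ψ y
      projection-cong x≈y = Linear.⟦⟧-cong φ x≈y , Linear.⟦⟧-cong ψ x≈y

      height-sum : ∀ {k} s (t x y : Vector Carrier k) →
        height s (sum (λ j → t j * x j) , sum (λ j → t j * y j)) ≈ sum (λ j → t j * height s (x j , y j))
      height-sum {zero}  s t x y = trans (+-congˡ (trans (-‿cong (zeroʳ s)) -0#≈0#)) (+-identityʳ 0#)
      height-sum {suc k} s t x y = trans
        (solve 6 (λ s t₀ x₀ y₀ X Y → t₀ :* y₀ :+ Y :- s :* (t₀ :* x₀ :+ X) := t₀ :* (y₀ :- s :* x₀) :+ (Y :- s :* X))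
          refl s _ _ _ _ _)
        (+-congˡ (height-sum s (t ∘ suc) (x ∘ suc) (y ∘ suc)))

      height-conv : ∀ {k s x} (points : Vector (Point n) k) ((t , _) : conv points x) →
        height s (projection φ ψ x) ≈ sum (λ j → t j * height s (projection φ ψ (points j)))
      height-conv {s = s} points (t , _ , _ , x≈) = trans
        (height-cong (trans (Linear.⟦⟧-cong φ x≈) (linear-sum φ t points) ,
                      trans (Linear.⟦⟧-cong ψ x≈) (linear-sum ψ t points)))
        (height-sum s t _ _)

      height-◇ : ∀ {s x} ((t , _) : ◇ n x) →
        height s (projection φ ψ x) ≈ sum (λ j → t j * height s (image (vertexAt j)))
      height-◇ {s} x∈◇@(t , _) = trans (height-conv generators x∈◇)
        (sum-cong-≋ {n ℕ.+ n} λ j → *-congˡ (reflexive (≡.cong (height s ∘ projection φ ψ) (generators-vertexAt j))))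

      -- Comparing with vertices suffices: by `height-◇` the height of any point of the
      -- cross-polytope is a weighted average of theirs.
      Lowest : Carrier → Vertex n → Set _
      Lowest s v = ∀ u → height s (image v) ≤ height s (image u)

      -- Allows any point `x` at the height of `v`, since an edge also needs its other end and the
      -- points in between.
      lowest⇒lowerFace : ∀ {s} v x → ◇ n x → height s (projection φ ψ x) ≈ height s (image v) →
        Lowest s v → LowerFace (shadow φ ψ) s (projection φ ψ x)
      lowest⇒lowerFace v x x∈◇ eq lowest =
        (x , x∈◇ , refl , refl) ,
        λ q (y , y∈◇@(t , 0≤t , ∑t≈1 , _) , y≈q) →
          ≤-respˡ-≈ (sym eq)
            (≤-respʳ-≈ (trans (sym (height-◇ y∈◇)) (height-cong y≈q))
              (Weights.average-≥ 0≤t ∑t≈1 λ j → lowest (vertexAt j)))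

      vertex-lowerFace : ∀ {s} v → Lowest s v → LowerFace (shadow φ ψ) s (image v)
      vertex-lowerFace v = lowest⇒lowerFace v (vertexPoint v) (vertex∈◇ v) refl

      lowerFace-support : ∀ {s} v {x} ((t , _) : ◇ n x) → Lowest s v →
        height s (projection φ ψ x) ≤ height s (image v) →
        ∀ j → height s (image v) < height s (image (vertexAt j)) → t j ≈ 0#
      lowerFace-support v x∈◇@(t , 0≤t , ∑t≈1 , _) lowest hx≤hv =
        Weights.complementary-slackness 0≤t ∑t≈1 (lowest ∘ vertexAt) (≤-respˡ-≈ (height-◇ x∈◇) hx≤hv)

      StrictlyLowest : Carrier → Vertex n → Set _
      StrictlyLowest s v = ∀ u → u ≢ v → height s (image v) < height s (image u)

      -- A point that minimises the height has no weight on vertices other than `v`, so its weight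
      -- at `v` is 1 and the point is `v` itself.
      strictlyLowest⇒lowerVertex : ∀ {s} v → StrictlyLowest s v → LowerVertex (shadow φ ψ) (image v)
      strictlyLowest⇒lowerVertex {s} v strictly = s , vertex-lowerFace v lowest , unique
        where
        lowest : Lowest s v
        lowest u with u ≟ᵛ v
        ... | yes ≡.refl = ≤-refl
        ... | no  u≢v    = inj₁ (strictly u u≢v)

        unique : ∀ q → LowerFace (shadow φ ψ) s q → q ≈₂ image v
        unique q ((x , x∈◇@(t , _ , ∑t≈1 , x≈) , πx≈q) , q-lowest) =
          trans (sym (proj₁ πx≈q)) (proj₁ πx≈πv) , trans (sym (proj₂ πx≈q)) (proj₂ πx≈πv)
          where
          k = position v
          t≈0 : ∀ j → j ≢ k → t j ≈ 0#
          t≈0 j j≢k = lowerFace-support v x∈◇ lowest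
            (≤-respˡ-≈ (sym (height-cong πx≈q)) (q-lowest _ (proj₁ (vertex-lowerFace v lowest))))
            j (strictly _ (≢position j≢k))
          πx≈πv : projection φ ψ x ≈₂ image v
          πx≈πv = projection-cong λ i → begin
            x i                                ≈⟨ x≈ i ⟩
            sum (λ j → t j * generators j i)   ≈⟨ sum-single k (λ j j≢k → trans (*-congʳ (t≈0 j j≢k)) (zeroˡ _)) ⟩
            t k * generators k i               ≈⟨ *-congʳ (trans (sym (sum-single k t≈0)) ∑t≈1) ⟩
            1# * generators k i                ≈⟨ *-identityˡ _ ⟩
            generators k i                     ≡⟨ ≡.cong (_$ i) (generators-position v) ⟩
            vertexPoint v i                    ∎

      -- If `u` were at the same height, its image would be in the lower face too, and uniqueness
      -- would give `u` and `v` the same value of φ.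
      lowerVertex⇒strictlyLowest : ∀ {p} v ((s , _) : LowerVertex (shadow φ ψ) p) → p ≈₂ image v →
        ∀ u → ¬ ⟦ φ ⟧ (vertexPoint u) ≈ ⟦ φ ⟧ (vertexPoint v) → height s (image v) < height s (image u)
      lowerVertex⇒strictlyLowest {p} v (s , (_ , lowest) , unique) p≈v u u≉v =
        <-respˡ-≈ (height-cong p≈v) (≤∧≉⇒< (lowest _ u∈shadow) λ hp≈hu →
          u≉v (trans (proj₁ (unique (image u) (u∈shadow , λ q q∈ → ≤-respˡ-≈ hp≈hu (lowest q q∈)))) (proj₁ p≈v)))
        where
        u∈shadow : shadow φ ψ (image u)
        u∈shadow = vertexPoint u , vertex∈◇ u , refl , refl

      lowest⇒lowerVertex-≈ : ∀ {p} v ((s , _) : LowerVertex (shadow φ ψ) p) → Lowest s v → image v ≈₂ p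
      lowest⇒lowerVertex-≈ v (s , _ , unique) lowest = unique _ (vertex-lowerFace v lowest)

      lowerVertex-resp-≈ : ∀ {p q} → p ≈₂ q → LowerVertex (shadow φ ψ) p → LowerVertex (shadow φ ψ) q
      lowerVertex-resp-≈ {p} {q} p≈q@(p₁≈q₁ , p₂≈q₂) (s , ((x , x∈◇ , x₁≈p₁ , x₂≈p₂) , lowest) , unique) =
        s , ((x , x∈◇ , trans x₁≈p₁ p₁≈q₁ , trans x₂≈p₂ p₂≈q₂) , λ r r∈ → ≤-respˡ-≈ (height-cong p≈q) (lowest r r∈)) ,
        λ r r-lower → let r₁≈p₁ , r₂≈p₂ = unique r r-lower in trans r₁≈p₁ p₁≈q₁ , trans r₂≈p₂ p₂≈q₂

      -- The height is constant along the segment. Conversely, a minimising point has weight on `v`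
      -- and `w` only, by complementary slackness, and thus lies on the segment.
      lowest-pair⇒lowerEdge : ∀ {s} v w → height s (image v) ≈ height s (image w) →
        ⟦ φ ⟧ (vertexPoint v) < ⟦ φ ⟧ (vertexPoint w) →
        (∀ u → u ≢ v → u ≢ w → height s (image v) < height s (image u)) →
        LowerEdge (shadow φ ψ) s ×
        (∀ x → segment v w x ⇔ (◇ n x × LowerFace (shadow φ ψ) s (projection φ ψ x)))
      lowest-pair⇒lowerEdge {s} v w hv≈hw φv<φw others =
        (image v , image w , vertex-lowerFace v lowest ,
          lowest⇒lowerFace v (vertexPoint w) (vertex∈◇ w) (sym hv≈hw) lowest ,
          λ v≈w → <-irrefl (proj₁ v≈w) φv<φw) ,
        λ x → mk⇔ (λ x∈vw → segment⊆◇ v w x∈vw , lowest⇒lowerFace v x (segment⊆◇ v w x∈vw) (height-segment x∈vw) lowest)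
                  (λ (x∈◇ , x-lower) → face⊆segment x∈◇ x-lower)
        where
        lowest : Lowest s v
        lowest u with u ≟ᵛ v | u ≟ᵛ w
        ... | yes ≡.refl | _          = ≤-refl
        ... | no _       | yes ≡.refl = inj₂ hv≈hw
        ... | no u≢v     | no u≢w     = inj₁ (others u u≢v u≢w)

        height-segment : ∀ {x} → segment v w x → height s (projection φ ψ x) ≈ height s (image v)
        height-segment {x} x∈vw@(t , _ , ∑t≈1 , _) = begin
          height s (projection φ ψ x)              ≈⟨ height-conv (vertexPoint v ∷ⱽ vertexPoint w ∷ⱽ []ⱽ) x∈vw ⟩
          t₀ * hv + (t₁ * height s (image w) + 0#) ≈⟨ +-congˡ (+-congʳ (*-congˡ hv≈hw)) ⟨
          t₀ * hv + (t₁ * hv + 0#)               ≈⟨ +-congˡ (+-congˡ (zeroˡ hv)) ⟨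
          -- The 0 that ends the sum is turned into a multiple of `hv`, so that `hv` factors out of
          -- all of `sum t`.
          t₀ * hv + (t₁ * hv + 0# * hv)          ≈⟨ solve 4 (λ t₀ t₁ z h → t₀ :* h :+ (t₁ :* h :+ z :* h) := (t₀ :+ (t₁ :+ z)) :* h) refl t₀ t₁ 0# hv ⟩
          sum t * hv                             ≈⟨ *-congʳ ∑t≈1 ⟩
          1# * hv                                ≈⟨ *-identityˡ hv ⟩
          hv                                     ∎
          where
          t₀ = t zero
          t₁ = t (suc zero)
          hv = height s (image v)

        face⊆segment : ∀ {x} → ◇ n x → LowerFace (shadow φ ψ) s (projection φ ψ x) → segment v w x
        face⊆segment {x} x∈◇@(t , 0≤t , ∑t≈1 , x≈) (_ , x-lowest) =
          t i ∷ⱽ t j ∷ⱽ []ⱽ ,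
          (λ { zero → 0≤t i ; (suc zero) → 0≤t j }) ,
          trans (+-congˡ (+-identityʳ _)) (trans (sym (sum-pair i j i≢j t≈0)) ∑t≈1) ,
          λ l → begin
            x l                                                    ≈⟨ x≈ l ⟩
            sum (λ k → t k * generators k l)                       ≈⟨ sum-pair i j i≢j (λ k k≢i k≢j → trans (*-congʳ (t≈0 k k≢i k≢j)) (zeroˡ _)) ⟩
            t i * generators i l + t j * generators j l            ≡⟨ ≡.cong₂ (λ p q → t i * p l + t j * q l) (generators-position v) (generators-position w) ⟩
            t i * vertexPoint v l + t j * vertexPoint w l          ≈⟨ +-congˡ (+-identityʳ _) ⟨
            t i * vertexPoint v l + (t j * vertexPoint w l + 0#)   ∎
          where
          i = position v
          j = position w
          i≢j : i ≢ j
          i≢j eq = <-irrefl (reflexive (≡.cong (⟦ φ ⟧ ∘ vertexPoint) (position-injective v w eq))) φv<φw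
          t≈0 : ∀ k → k ≢ i → k ≢ j → t k ≈ 0#
          t≈0 k k≢i k≢j = lowerFace-support v x∈◇ lowest (x-lowest _ (proj₁ (vertex-lowerFace v lowest)))
            k (others _ (≢position k≢i) (≢position k≢j))

-- Monotone paths

module _ {a} {A : Set a} where

  ∈-insertAt⁺ : ∀ {x v : A} xs i → x ∈ xs → x ∈ insertAt xs i v
  ∈-insertAt⁺ xs       zero    x∈xs         = there x∈xs
  ∈-insertAt⁺ (_ ∷ xs) (suc i) (here x≡y)   = here x≡y
  ∈-insertAt⁺ (_ ∷ xs) (suc i) (there x∈xs) = there (∈-insertAt⁺ xs i x∈xs)

  ∈-insertAt⁻ : ∀ {x v : A} xs i → x ∈ insertAt xs i v → x ≡ v ⊎ x ∈ xs
  ∈-insertAt⁻ xs       zero    (here x≡v)   = inj₁ x≡v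
  ∈-insertAt⁻ xs       zero    (there x∈xs) = inj₂ x∈xs
  ∈-insertAt⁻ (_ ∷ xs) (suc i) (here x≡y)   = inj₂ (here x≡y)
  ∈-insertAt⁻ (_ ∷ xs) (suc i) (there x∈)   = [ inj₁ , inj₂ ∘ there ]′ (∈-insertAt⁻ xs i x∈)

  head-∈ : ∀ {x : A} xs → head xs ≡ just x → x ∈ xs
  head-∈ (_ ∷ _) ≡.refl = here ≡.refl

  last-∈ : ∀ {x : A} xs → last xs ≡ just x → x ∈ xs
  last-∈ (_ ∷ [])     ≡.refl = here ≡.refl
  last-∈ (_ ∷ y ∷ xs) eq     = there (last-∈ (y ∷ xs) eq)

  module _ {r} {R : Rel A r} where

    head-minimal : ∀ {x xs} → AllPairs R xs → x ∈ xs → (∀ y → ¬ R y x) → head xs ≡ just x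
    head-minimal _         (here ≡.refl) _   = ≡.refl
    head-minimal (y< ∷ _)  (there x∈xs)  min = contradiction (All.lookup y< x∈xs) (min _)

    last-maximal : ∀ {x xs} → AllPairs R xs → x ∈ xs → (∀ y → ¬ R x y) → last xs ≡ just x
    last-maximal {xs = _ ∷ []}     _          (here ≡.refl) _   = ≡.refl
    last-maximal {xs = _ ∷ _ ∷ _} (x< ∷ _)   (here ≡.refl) max = contradiction (All.head x<) (max _)
    last-maximal {xs = _ ∷ _ ∷ _} (_ ∷ rest) (there x∈xs)  max = last-maximal rest x∈xs max

    AllPairs-reverse : ∀ {xs} → AllPairs (flip R) xs → AllPairs R (reverse xs)
    AllPairs-reverse []                    = []
    AllPairs-reverse {x ∷ xs} (x~xs ∷ xs~) = ≡.subst (AllPairs R) (≡.sym (List.unfold-reverse x xs))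
      (AllPairs.++⁺ (AllPairs-reverse xs~) ([] ∷ [])
        (All.tabulate λ y∈ → All.lookup x~xs (Any.reverse⁻ y∈) ∷ []))

-- At most one entry of a list without repetitions equals `i`. This is why deleting one vertex
-- destroys at most one pair.
Unique⇒length-filter : ∀ {n} (i : Fin n) {is} → Unique is →
  length is ℕ.≤ suc (length (filter (λ j → ¬? (j Fin.≟ i)) is))
Unique⇒length-filter i [] = z≤n
Unique⇒length-filter i {j ∷ is} (j∉is ∷ is!) with j Fin.≟ i
... | yes ≡.refl = s≤s (ℕ.≤-reflexive (≡.cong length (≡.sym
        (List.filter-all _ (All.map (λ j≢k → j≢k ∘ ≡.sym) j∉is)))))
... | no _       = s≤s (Unique⇒length-filter i is!)

-- Antipodal pairs and deletion of vertices

Paired : ∀ {n} → List (Vertex n) → Fin n → Set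
Paired vs i = (Sign.- , i) ∈ vs × (Sign.+ , i) ∈ vs

paired : ∀ {n} {vs : List (Vertex n)} v → v ∈ vs → antipode v ∈ vs → Paired vs (proj₂ v)
paired (Sign.+ , i) v∈vs -v∈vs = -v∈vs , v∈vs
paired (Sign.- , i) v∈vs -v∈vs = v∈vs , -v∈vs

paired? : ∀ {n} (vs : List (Vertex n)) i → Dec (Paired vs i)
paired? vs i = ((Sign.- , i) ∈? vs) ×-dec ((Sign.+ , i) ∈? vs)
  where open Data.List.Membership.DecPropositional _≟ᵛ_

other? : ∀ {n} (v u : Vertex n) → Dec (u ≢ v)
other? v u = ¬? (u ≟ᵛ v)

delete : ∀ {n} → Vertex n → List (Vertex n) → List (Vertex n)
delete v = filter (other? v)

-- The pairs of the extremal path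

neg∈extremalPath : ∀ {n} (i : Fin n) → (Sign.- , i) ∈ extremalPath n
neg∈extremalPath i = ∈-++⁺ˡ (∈-map⁺ _ (Any.reverse⁺ (∈-allFin i)))

pos∈extremalPath : ∀ {n} (i : Fin n) → (Sign.+ , suc i) ∈ extremalPath (suc n)
pos∈extremalPath i = ∈-++⁺ʳ (map (Sign.- ,_) (reverse (allFin _))) (∈-map⁺ _ (∈-tabulate⁺ i))

+e₁∉extremalPath : ∀ {n} → (Sign.+ , zero) ∉ extremalPath (suc n)
+e₁∉extremalPath {n} e₁∈ with ∈-++⁻ (map (Sign.- ,_) (reverse (allFin (suc n)))) e₁∈
... | inj₁ e₁∈neg with _ , _ , () ← ∈-map⁻ _ e₁∈neg
... | inj₂ e₁∈pos with i , i∈ , eq ← ∈-map⁻ _ e₁∈pos with j , ≡.refl ← ∈-tabulate⁻ i∈ with () ← eq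

-- These are the 0-based indices 1 to M in dimension n = M + 2, that is, all but the first and the
-- last.
innerIndices : ∀ M → List (Fin (2 ℕ.+ M))
innerIndices M = tabulate (suc ∘ inject₁)

extremalPath-paired : ∀ M → All (Paired (extremalPath (2 ℕ.+ M))) (innerIndices M)
extremalPath-paired M = All.tabulate⁺ λ i → neg∈extremalPath (suc (inject₁ i)) , pos∈extremalPath (inject₁ i)

innerIndices≢last : ∀ M → All (_≢ fromℕ (suc M)) (innerIndices M)
innerIndices≢last M = All.tabulate⁺ λ i eq → Fin.fromℕ≢inject₁ (≡.sym (Fin.suc-injective eq))

innerIndices-unique : ∀ M → Unique (innerIndices M)
innerIndices-unique M = Unique.tabulate⁺ (Fin.inject₁-injective ∘ Fin.suc-injective)

module _ {c ℓ₁ ℓ₂} (F : OrderedField c ℓ₁ ℓ₂) where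
  open OrderedField F hiding (zero)
  open CrossPolytope F
  open OrderedFieldProperties F
  open CrossPolytopeProperties F
  open Relation.Binary.Reasoning.Setoid setoid

  -- The order of the vertices by φ

  module MonotonePaths {N : ℕ} (φ : LinearFunctional (suc N)) (a : Vector Carrier (suc N))
    (φe≈a : ∀ i → ⟦ φ ⟧ (e i) ≈ a i) (0<a : ∀ i → 0# < a i) (a-mono : ∀ i j → i Fin.< j → a i < a j) where

    n : ℕ
    n = suc N

    top bot : Vertex n
    top = Sign.+ , fromℕ N
    bot = Sign.- , fromℕ N

    φᵛ : Vertex n → Carrier
    φᵛ v = ⟦ φ ⟧ (vertexPoint v)

    φᵛ-neg : ∀ i → φᵛ (Sign.- , i) ≈ - a i
    φᵛ-neg i = trans (linear-antipode φ (Sign.+ , i)) (-‿cong (φe≈a i))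

    infix 4 _≺_
    _≺_ : Rel (Vertex n) ℓ₂
    v ≺ w = φᵛ v < φᵛ w

    a-mono-≤ : ∀ {i j} → i Fin.≤ j → a i ≤ a j
    a-mono-≤ {i} {j} i≤j with i Fin.≟ j
    ... | yes ≡.refl = ≤-refl
    ... | no  i≢j    = inj₁ (a-mono i j (Fin.≤∧≢⇒< i≤j i≢j))

    a-injective : ∀ {i j} → a i ≈ a j → i ≡ j
    a-injective {i} {j} eq with Fin.<-cmp i j
    ... | tri< i<j _ _ = contradiction (a-mono i j i<j) (<-irrefl eq)
    ... | tri≈ _ i≡j _ = i≡j
    ... | tri> _ _ j<i = contradiction (a-mono j i j<i) (<-irrefl (sym eq))

    -a<a : ∀ i j → - a i < a j
    -a<a i j = <-trans (neg-neg (0<a i)) (0<a j)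

    neg≺pos : ∀ i j → (Sign.- , i) ≺ (Sign.+ , j)
    neg≺pos i j = <-respˡ-≈ (sym (φᵛ-neg i)) (<-respʳ-≈ (sym (φe≈a j)) (-a<a i j))

    pos≺pos : ∀ i j → i Fin.< j → (Sign.+ , i) ≺ (Sign.+ , j)
    pos≺pos i j i<j = <-respˡ-≈ (sym (φe≈a i)) (<-respʳ-≈ (sym (φe≈a j)) (a-mono i j i<j))

    neg≺neg : ∀ i j → j Fin.< i → (Sign.- , i) ≺ (Sign.- , j)
    neg≺neg i j j<i = <-respˡ-≈ (sym (φᵛ-neg i)) (<-respʳ-≈ (sym (φᵛ-neg j)) (neg-mono-< (a-mono j i j<i)))

    φᵛ-injective : ∀ v w → φᵛ v ≈ φᵛ w → v ≡ w
    φᵛ-injective (Sign.+ , i) (Sign.+ , j) eq =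
      ≡.cong (Sign.+ ,_) (a-injective (trans (sym (φe≈a i)) (trans eq (φe≈a j))))
    φᵛ-injective (Sign.+ , i) (Sign.- , j) eq = contradiction (neg≺pos j i) (<-irrefl (sym eq))
    φᵛ-injective (Sign.- , i) (Sign.+ , j) eq = contradiction (neg≺pos i j) (<-irrefl eq)
    φᵛ-injective (Sign.- , i) (Sign.- , j) eq = ≡.cong (Sign.- ,_) (a-injective (begin
      a i              ≈⟨ solve 1 (λ x → x := :- (:- x)) refl (a i) ⟩
      - (- a i)        ≈⟨ -‿cong (trans (sym (φᵛ-neg i)) (trans eq (φᵛ-neg j))) ⟩
      - (- a j)        ≈⟨ solve 1 (λ x → x := :- (:- x)) refl (a j) ⟨
      a j              ∎))

    -- The order is -eₙ ≺ ... ≺ -e₁ ≺ e₁ ≺ ... ≺ eₙ. With the converse `≺-between⁻`, separating an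
    -- antipodal pair amounts to having a smaller index.
    ≺-between : ∀ u {i} → proj₂ u Fin.< i → (Sign.- , i) ≺ u × u ≺ (Sign.+ , i)
    ≺-between (Sign.+ , j) {i} j<i = neg≺pos i j , pos≺pos j i j<i
    ≺-between (Sign.- , j) {i} j<i = neg≺neg i j j<i , neg≺pos j i

    ≺-between⁻ : ∀ u {i} → (Sign.- , i) ≺ u → u ≺ (Sign.+ , i) → proj₂ u Fin.< i
    ≺-between⁻ (s , j) {i} -i≺u u≺i with Fin.<-cmp j i
    ... | tri< j<i _ _ = j<i
    ≺-between⁻ (Sign.+ , j) {i} -i≺u u≺i | tri≈ _ ≡.refl _ = contradiction u≺i (<-irrefl refl)
    ≺-between⁻ (Sign.- , j) {i} -i≺u u≺i | tri≈ _ ≡.refl _ = contradiction -i≺u (<-irrefl refl)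
    ≺-between⁻ (Sign.+ , j) {i} -i≺u u≺i | tri> _ _ i<j = contradiction u≺i (<-asym (pos≺pos i j i<j))
    ≺-between⁻ (Sign.- , j) {i} -i≺u u≺i | tri> _ _ i<j = contradiction -i≺u (<-asym (neg≺neg j i i<j))

    bot-or-bot≺ : ∀ u → u ≡ bot ⊎ bot ≺ u
    bot-or-bot≺ (Sign.+ , i) = inj₂ (neg≺pos (fromℕ N) i)
    bot-or-bot≺ (Sign.- , i) with i Fin.≟ fromℕ N
    ... | yes ≡.refl = inj₁ ≡.refl
    ... | no  i≢N    = inj₂ (neg≺neg (fromℕ N) i (Fin.≤∧≢⇒< (Fin.≤fromℕ i) i≢N))

    top-or-≺top : ∀ u → u ≡ top ⊎ u ≺ top
    top-or-≺top (Sign.- , i) = inj₂ (neg≺pos i (fromℕ N))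
    top-or-≺top (Sign.+ , i) with i Fin.≟ fromℕ N
    ... | yes ≡.refl = inj₁ ≡.refl
    ... | no  i≢N    = inj₂ (pos≺pos i (fromℕ N) (Fin.≤∧≢⇒< (Fin.≤fromℕ i) i≢N))

    bot-minimal : ∀ u → ¬ u ≺ bot
    bot-minimal u u≺bot with bot-or-bot≺ u
    ... | inj₁ ≡.refl = <-irrefl refl u≺bot
    ... | inj₂ bot≺u  = <-asym u≺bot bot≺u

    top-maximal : ∀ u → ¬ top ≺ u
    top-maximal u top≺u with top-or-≺top u
    ... | inj₁ ≡.refl = <-irrefl refl top≺u
    ... | inj₂ u≺top  = <-asym top≺u u≺top

    -- Sorted lists and monotone paths

    Consecutive : List (Vertex n) → Rel (Vertex n) _
    Consecutive us v w = v ∈ us × w ∈ us × v ≺ w × (∀ {u} → u ∈ us → ¬ (v ≺ u × u ≺ w))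

    -- Neighbours are described by membership and order alone, the form in which both the steps and
    -- the lower edges are derived.
    sorted⇒consecutive : ∀ {vs} → AllPairs _≺_ vs → Linked (Consecutive vs) vs
    sorted⇒consecutive sorted = go sorted id inj₁
      where
      -- The whole list `us` stays fixed while `vs` runs through its suffixes; the last hypothesis
      -- says that the vertices already passed precede all of `vs`.
      go : ∀ {us vs} → AllPairs _≺_ vs → (∀ {u} → u ∈ vs → u ∈ us) →
           (∀ {u} → u ∈ us → u ∈ vs ⊎ All (u ≺_) vs) → Linked (Consecutive us) vs
      go []       _  _ = []
      go ([] ∷ _) _  _ = [-]
      go {us} {v ∷ w ∷ vs} ((v≺w ∷ v≺vs) ∷ rest@(w≺vs ∷ _)) ⊆us split =
        (⊆us (here ≡.refl) , ⊆us (there (here ≡.refl)) , v≺w , nothing-between) ∷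
        go rest (⊆us ∘ there) split′
        where
        nothing-between : ∀ {u} → u ∈ us → ¬ (v ≺ u × u ≺ w)
        nothing-between u∈us (v≺u , u≺w) with split u∈us
        ... | inj₁ (here ≡.refl)         = <-irrefl refl v≺u
        ... | inj₁ (there (here ≡.refl)) = <-irrefl refl u≺w
        ... | inj₁ (there (there u∈vs))  = <-asym u≺w (All.lookup w≺vs u∈vs)
        ... | inj₂ (u≺v ∷ _)             = <-asym u≺v v≺u
        split′ : ∀ {u} → u ∈ us → u ∈ w ∷ vs ⊎ All (u ≺_) (w ∷ vs)
        split′ u∈us with split u∈us
        ... | inj₁ (here ≡.refl) = inj₂ (v≺w ∷ v≺vs)
        ... | inj₁ (there u∈)    = inj₁ u∈
        ... | inj₂ (_ ∷ u≺)      = inj₂ u≺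

    steps⇒sorted : ∀ {vs} → Linked (Step φ) vs → AllPairs _≺_ vs
    steps⇒sorted path = Linked.Linked⇒AllPairs <-trans (Linked.map proj₂ path)

    -- The successor of `v` on the path is either `w` or strictly between the two. For an antipodal
    -- pair the first case is impossible.
    step-or-between : ∀ {vs} v w → Linked (Step φ) vs → v ∈ vs → w ∈ vs → v ≺ w →
      Step φ v w ⊎ ∃[ u ] u ∈ vs × v ≺ u × u ≺ w
    step-or-between v w path v∈vs w∈vs v≺w = go (steps⇒sorted path) path v∈vs w∈vs
      where
      go : ∀ {vs} → AllPairs _≺_ vs → Linked (Step φ) vs → v ∈ vs → w ∈ vs →
           Step φ v w ⊎ ∃[ u ] u ∈ vs × v ≺ u × u ≺ w
      go sorted path (here ≡.refl) (here ≡.refl) = contradiction v≺w (<-irrefl refl)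
      go sorted (step ∷ _) (here ≡.refl) (there (here ≡.refl)) = inj₁ step
      go (_ ∷ w≺ ∷ _) (step ∷ _) (here ≡.refl) (there (there w∈)) =
        inj₂ (_ , there (here ≡.refl) , proj₂ step , All.lookup w≺ w∈)
      go (w≺ ∷ _) _ (there v∈) (here ≡.refl) = contradiction (All.lookup w≺ v∈) (<-asym v≺w)
      go (_ ∷ sorted) path (there v∈) (there w∈) with go sorted (Linked.tail path) v∈ w∈
      ... | inj₁ step                 = inj₁ step
      ... | inj₂ (u , u∈ , v≺u , u≺w) = inj₂ (u , there u∈ , v≺u , u≺w)

    -- A sorted list of vertices is a monotone path as soon as it has a pivot
    -- of smaller index than each of its antipodal pairs, since the pivot
    -- separates all these pairs. Unlike the condition on consecutive
    -- vertices, this is inherited by sublists that retain the pivot.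
    record Separated (vs : List (Vertex n)) : Set ℓ₂ where
      field
        sorted    : AllPairs _≺_ vs
        bot∈      : bot ∈ vs
        top∈      : top ∈ vs
        pivot     : Vertex n
        pivot∈    : pivot ∈ vs
        separates : ∀ {i} → Paired vs i → proj₂ pivot Fin.< i

    consecutive⇒step : ∀ {vs} → Separated vs → ∀ {v w} → Consecutive vs v w → Step φ v w
    -- If `v` were the antipode of `w`, the pivot would lie strictly between them.
    consecutive⇒step sep {w = Sign.+ , i} (v∈vs , w∈vs , v≺w , nothing-between) =
      (λ { ≡.refl → nothing-between pivot∈ (≺-between pivot (separates (v∈vs , w∈vs))) }) , v≺w
      where open Separated sep
    -- Here the antipode of `w` is positive and comes after `w`.
    consecutive⇒step sep {w = Sign.- , i} (v∈vs , w∈vs , v≺w , nothing-between) =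
      (λ { ≡.refl → <-asym v≺w (neg≺pos i i) }) , v≺w

    separated⇒monotone : ∀ {vs} → Separated vs → MonotonePath φ vs
    separated⇒monotone sep = record
      { starts = head-minimal sorted bot∈ bot-minimal
      ; ends   = last-maximal sorted top∈ top-maximal
      ; steps  = Linked.map (consecutive⇒step sep) (sorted⇒consecutive sorted)
      }
      where open Separated sep

    monotone⇒separated : ∀ {vs} → MonotonePath φ vs → Separated vs
    monotone⇒separated {vs} path = record
      { sorted    = steps⇒sorted steps
      ; bot∈      = bot∈
      ; top∈      = last-∈ vs ends
      ; pivot     = pivot
      ; pivot∈    = pivot∈
      ; separates = separates
      }
      where
      open MonotonePath path
      index : Vertex n → ℕ
      index = toℕ ∘ proj₂
      bot∈ : bot ∈ vs
      bot∈ = head-∈ vs starts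
      -- The pivot is a vertex of least index. The default value `bot` is on the path, so the pivot
      -- is as well.
      pivot = argmin ℕ.≤-totalOrder index bot vs
      pivot∈ : pivot ∈ vs
      pivot∈ = argmin-all ℕ.≤-totalOrder index bot∈ (All.tabulate id)
      separates : ∀ {i} → Paired vs i → proj₂ pivot Fin.< i
      -- An antipodal pair is not a step, so some path vertex `u` lies strictly between its members.
      -- The index of `u` is below `i`, and that of the pivot is no larger.
      separates {i} (-i∈ , i∈) with step-or-between (Sign.- , i) (Sign.+ , i) steps -i∈ i∈ (neg≺pos i i)
      ... | inj₁ (not-antipodal , _)     = contradiction ≡.refl not-antipodal
      ... | inj₂ (u , u∈ , -i≺u , u≺i) =
        ℕ.≤-<-trans (All.lookup (f[argmin]≤f[xs] ℕ.≤-totalOrder bot vs) u∈) (≺-between⁻ u -i≺u u≺i)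

    delete-separated : ∀ {vs v} (sep : Separated vs) → v ≢ bot → v ≢ top → v ≢ Separated.pivot sep →
      Separated (delete v vs)
    delete-separated {vs} {v} sep v≢bot v≢top v≢pivot = record
      { sorted    = AllPairs.filter⁺ keep? sorted
      ; bot∈      = ∈-filter⁺ keep? bot∈ (v≢bot ∘ ≡.sym)
      ; top∈      = ∈-filter⁺ keep? top∈ (v≢top ∘ ≡.sym)
      ; pivot     = pivot
      ; pivot∈    = ∈-filter⁺ keep? pivot∈ (v≢pivot ∘ ≡.sym)
      ; separates = λ (-i∈ , i∈) → separates (proj₁ (∈-filter⁻ keep? -i∈) , proj₁ (∈-filter⁻ keep? i∈))
      }
      where
      open Separated sep
      keep? = other? v

    -- A strictly sorted list has no repetitions, so filtering out `v` removes a single entry, as a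
    -- flip requires.
    insertion-delete : ∀ {vs v} → AllPairs _≺_ vs → v ∈ vs → Insertion φ (delete v vs) vs
    insertion-delete {v ∷ vs} (v≺vs ∷ _) (here ≡.refl) =
      ≡.subst (λ us → Insertion φ us (v ∷ vs)) (≡.sym delete-head) (zero , v , ≡.refl)
      where
      delete-head : delete v (v ∷ vs) ≡ vs
      delete-head = ≡.trans (List.filter-reject (other? v) {x = v} {xs = vs} (_$ ≡.refl))
        (List.filter-all (other? v) (All.map (λ { v≺u ≡.refl → <-irrefl refl v≺u }) v≺vs))
    insertion-delete {u ∷ vs} {v} (u≺vs ∷ sorted) (there v∈vs) =
      ≡.subst (λ us → Insertion φ us (u ∷ vs)) (≡.sym (List.filter-accept (other? v) {xs = vs} u≢v))
        (let i , w , eq = insertion-delete sorted v∈vs in suc i , w , ≡.cong (u ∷_) eq)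
      where
      u≢v : u ≢ v
      u≢v ≡.refl = <-irrefl refl (All.lookup u≺vs v∈vs)

    delete-flip : ∀ {vs v} → (sep : Separated vs) → v ≢ bot → v ≢ top → v ≢ Separated.pivot sep →
      v ∈ vs → Flip φ vs (delete v vs)
    delete-flip sep v≢bot v≢top v≢pivot v∈vs =
      separated⇒monotone sep , separated⇒monotone (delete-separated sep v≢bot v≢top v≢pivot) ,
      inj₂ (insertion-delete (Separated.sorted sep) v∈vs)

    -- Walks and the number of pairs

    Unpaired : List (Vertex n) → Set
    Unpaired vs = ∀ {i} → Paired vs i → i ≡ fromℕ N

    -- Induction on a bound `k` for the paired indices other than the last. Each of them costs one
    -- deletion, and index 0 is never paired, because the pivot would need a smaller index; hence k
    -- ∸ 1.
    walk-to-unpaired : ∀ k → k ℕ.≤ N → ∀ {vs} → Separated vs →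
      (∀ {i} → Paired vs i → i ≡ fromℕ N ⊎ toℕ i ℕ.< k) →
      ∃[ ws ] Separated ws × Unpaired ws × (Σ (Walk φ vs ws) λ w → walkLength w ℕ.≤ k ∸ 1)
    walk-to-unpaired zero _ {vs} sep bound =
      vs , sep , (λ i∈ → [ id , (λ ()) ]′ (bound i∈)) , ε , z≤n
    walk-to-unpaired (suc k) k<N {vs} sep bound with paired? vs (fromℕ< (ℕ.m<n⇒m<1+n k<N))
    ... | no unpaired =
      let ws , sep′ , unpaired′ , w , w≤ = walk-to-unpaired k (ℕ.<⇒≤ k<N) sep bound′
      in ws , sep′ , unpaired′ , w , ℕ.≤-trans w≤ (ℕ.m∸n≤m k 1)
      where
      bound′ : ∀ {i} → Paired vs i → i ≡ fromℕ N ⊎ toℕ i ℕ.< k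
      bound′ {i} i∈ with bound i∈ | toℕ i ℕ.≟ k
      ... | inj₁ i≡N | _          = inj₁ i≡N
      ... | inj₂ _   | yes ≡.refl = contradiction
              (≡.subst (Paired vs) (≡.sym (Fin.fromℕ<-toℕ i _)) i∈) unpaired
      ... | inj₂ i≤k | no i≢k     = inj₂ (ℕ.≤∧≢⇒< (ℕ.s≤s⁻¹ i≤k) i≢k)
    ... | yes i∈@(_ , v∈) =
      let ws , sep′ , unpaired , w , w≤ = walk-to-unpaired k (ℕ.<⇒≤ k<N)
            (delete-separated sep (λ ()) v≢top v≢pivot) bound′
      in ws , sep′ , unpaired , delete-flip sep (λ ()) v≢top v≢pivot v∈ ◅ w ,
         ℕ.≤-trans (s≤s w≤) (ℕ.≤-reflexive (ℕ.m+[n∸m]≡n 0<k))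
      where
      i = fromℕ< (ℕ.m<n⇒m<1+n k<N)
      v : Vertex n
      -- The positive vertex can always be the one removed: it differs from `bot` in sign, and from
      -- `top` and the pivot in index.
      v = Sign.+ , i
      toℕ-i : toℕ i ≡ k
      toℕ-i = Fin.toℕ-fromℕ< _
      -- The pivot has an index below `k`. Positivity of `k` makes 1 + (k ∸ 1) equal to `k`, without
      -- loss from truncated subtraction.
      0<k : 0 ℕ.< k
      0<k = ℕ.<-≤-trans (ℕ.≤-<-trans z≤n (Separated.separates sep i∈)) (ℕ.≤-reflexive toℕ-i)
      v≢top : v ≢ top
      v≢top eq = ℕ.<-irrefl (≡.trans (≡.sym toℕ-i) (≡.trans (≡.cong (toℕ ∘ proj₂) eq) (Fin.toℕ-fromℕ N))) k<N
      v≢pivot : v ≢ Separated.pivot sep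
      v≢pivot eq = ℕ.<-irrefl (≡.cong (toℕ ∘ proj₂) (≡.sym eq)) (Separated.separates sep i∈)
      bound′ : ∀ {j} → Paired (delete v vs) j → j ≡ fromℕ N ⊎ toℕ j ℕ.< k
      bound′ {j} (-j∈ , j∈) with bound (proj₁ (∈-filter⁻ (other? v) -j∈) , proj₁ (∈-filter⁻ (other? v) j∈))
      ... | inj₁ j≡N = inj₁ j≡N
      ... | inj₂ j≤k = inj₂ (ℕ.≤∧≢⇒< (ℕ.s≤s⁻¹ j≤k) λ j≡k → proj₂ (∈-filter⁻ (other? v) {xs = vs} j∈)
              (≡.cong (Sign.+ ,_) (Fin.toℕ-injective (≡.trans j≡k (≡.sym toℕ-i)))))

    -- Induction on the walk: an insertion keeps every pair, a deletion loses at most the pair with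
    -- the index of the deleted vertex, and at the end none of the listed pairs may be left.
    pairs≤walkLength : ∀ {vs ws} (w : Walk φ vs ws) → Unpaired ws → ∀ {is} → Unique is →
      All (_≢ fromℕ N) is → All (Paired vs) is → length is ℕ.≤ walkLength w
    pairs≤walkLength ε unpaired [] _ _ = z≤n
    pairs≤walkLength ε unpaired (_ ∷ _) (i≢N ∷ _) (i∈ ∷ _) = contradiction (unpaired i∈) i≢N
    pairs≤walkLength ((_ , _ , inj₁ (k , v , ≡.refl)) ◅ w) unpaired is! is≢N is∈ = ℕ.m≤n⇒m≤1+n
      (pairs≤walkLength w unpaired is! is≢N
        (All.map (λ (-i∈ , i∈) → ∈-insertAt⁺ _ k -i∈ , ∈-insertAt⁺ _ k i∈) is∈))
    pairs≤walkLength {ws = ws} (_◅_ {j = us} (_ , _ , inj₂ (k , v , ≡.refl)) w) unpaired {is} is! is≢N is∈ =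
      ℕ.≤-trans (Unique⇒length-filter (proj₂ v) is!) (s≤s
        (pairs≤walkLength w unpaired (Unique.filter⁺ keep? is!) (All.filter⁺ keep? is≢N)
          (All.tabulate λ i∈ → let i∈is , i≢v = ∈-filter⁻ keep? i∈
                                   -i∈vs , i∈vs = All.lookup is∈ i∈is
                               in survives -i∈vs i≢v , survives i∈vs i≢v)))
      where
      keep? = λ j → ¬? (j Fin.≟ proj₂ v)
      survives : ∀ {u} → u ∈ insertAt us k v → proj₂ u ≢ proj₂ v → u ∈ us
      survives u∈ u≢v = [ (λ u≡v → contradiction (≡.cong proj₂ u≡v) u≢v) , id ]′ (∈-insertAt⁻ us k u∈)

    -- Coherent paths and unpaired paths

    coherent⇒unpaired : ∀ {vs} → Coherent φ vs → Unpaired vs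
    coherent⇒unpaired {vs} coherent {i} (-i∈ , i∈) with i Fin.≟ fromℕ N
    ... | yes i≡N = i≡N
    -- Both eᵢ and -eᵢ are lower vertices, each strictly below eₙ and -eₙ for the slope of its own
    -- supporting line. After rewriting antipodal images as negatives, these are the four
    -- inequalities of `¬antipodal-lower`, with (A , Y) the image of eₙ.
    ... | no  i≢N = contradiction
            (<-respˡ-≈ (height-cong (antipode-image v)) (<-respʳ-≈ (height-cong (antipode-image top)) (below -i∈ bot (i≢N ∘ ≡.sym))))
            (¬antipodal-lower
              (<-respˡ-≈ (linear-antipode φ top) (proj₁ bounds)) (proj₂ bounds)
              (below i∈ top (i≢N ∘ ≡.sym))
              (<-respʳ-≈ (height-cong (antipode-image top)) (below i∈ bot (i≢N ∘ ≡.sym)))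
              (<-respˡ-≈ (height-cong (antipode-image v)) (below -i∈ top (i≢N ∘ ≡.sym))))
      where
      open Coherent coherent
      open Projection φ ψ
      v : Vertex n
      v = Sign.+ , i
      bounds : bot ≺ v × v ≺ top
      bounds = ≺-between v (Fin.≤∧≢⇒< (Fin.≤fromℕ i) i≢N)
      antipode-image : ∀ u → image (antipode u) ≈₂ (- φᵛ u , - ⟦ ψ ⟧ (vertexPoint u))
      antipode-image u = linear-antipode φ u , linear-antipode ψ u
      lower : ∀ {u} → u ∈ vs → LowerVertex (shadow φ ψ) (image u)
      lower u∈vs = Equivalence.from (lowerVertices _) (lose u∈vs (refl , refl))
      below : ∀ {u} (u∈vs : u ∈ vs) w → proj₂ w ≢ proj₂ u →
        height (proj₁ (lower u∈vs)) (image u) < height (proj₁ (lower u∈vs)) (image w)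
      below {u} u∈vs w w≢u = lowerVertex⇒strictlyLowest u (lower u∈vs) (refl , refl) w
        (w≢u ∘ ≡.cong proj₂ ∘ φᵛ-injective w u)

    unpaired⇒coherent : ∀ {vs} → Separated vs → Unpaired vs → Coherent φ vs
    unpaired⇒coherent {vs} sep unpaired = record
      { monotone      = separated⇒monotone sep
      ; ψ             = ψ
      ; lowerVertices = λ p → mk⇔ (lowerVertex⇒path {p}) (path⇒lowerVertex {p})
      ; lowerEdges    = Linked.map consecutive⇒lowerEdge (sorted⇒consecutive sorted)
      }
      where
      open Separated sep
      open Data.List.Membership.DecPropositional (_≟ᵛ_ {n}) using (_∈?_)

      A : Carrier
      A = φᵛ top
      open Parabola A

      infix 8 _if_else-if_
      -- The decisions are explicit arguments, so that values of `lift` can be found by matching on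
      -- them. The second branch negates because it prescribes `d` at -eᵢ.
      _if_else-if_ : ∀ {P Q : Set} → Carrier → Dec P → Dec Q → Carrier
      d if yes _ else-if _     = d
      d if no _  else-if yes _ = - d
      d if no _  else-if no _  = 0#

      -- Path vertices are lifted to the parabola y = x² - A² through π(±eₙ) =
      -- (±A , 0); their antipodes then lie above the x-axis, and the images
      -- of the remaining vertices on it.
      lift : Vector Carrier n
      lift i = parabola (φᵛ (Sign.+ , i)) if (Sign.+ , i) ∈? vs else-if ((Sign.- , i) ∈? vs)

      ψ : LinearFunctional n
      ψ = functional lift

      open Projection φ ψ

      ψᵛ : Vertex n → Carrier
      ψᵛ v = ⟦ ψ ⟧ (vertexPoint v)

      ψᵛ-neg : ∀ i → ψᵛ (Sign.- , i) ≈ - lift i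
      ψᵛ-neg i = trans (linear-antipode ψ (Sign.+ , i)) (-‿cong (functional-e lift i))

      parabola-top : parabola A ≈ 0#
      parabola-top = -‿inverseʳ (A * A)

      parabola-antipode : ∀ v → parabola (φᵛ (antipode v)) ≈ parabola (φᵛ v)
      parabola-antipode v = +-congʳ (trans (*-cong (linear-antipode φ v) (linear-antipode φ v))
        (solve 1 (λ x → :- x :* :- x := x :* x) refl (φᵛ v)))

      ψᵛ-path : ∀ {v} → v ∈ vs → ψᵛ v ≈ parabola (φᵛ v)
      ψᵛ-path {Sign.+ , i} v∈vs = trans (functional-e lift i) (on ((Sign.+ , i) ∈? vs) ((Sign.- , i) ∈? vs))
        where
        on : ∀ {Q} (p? : Dec ((Sign.+ , i) ∈ vs)) (q? : Dec Q) →
             parabola (φᵛ (Sign.+ , i)) if p? else-if q? ≈ parabola (φᵛ (Sign.+ , i))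
        on (yes _)   _ = refl
        on (no v∉vs) _ = contradiction v∈vs v∉vs
      ψᵛ-path {Sign.- , i} v∈vs = trans (ψᵛ-neg i)
        (trans (on ((Sign.+ , i) ∈? vs) ((Sign.- , i) ∈? vs)) (sym (parabola-antipode (Sign.+ , i))))
        where
        d = parabola (φᵛ (Sign.+ , i))
        on : (p? : Dec ((Sign.+ , i) ∈ vs)) (q? : Dec ((Sign.- , i) ∈ vs)) → - (d if p? else-if q?) ≈ d
        -- Both signs occur only at the last index, where the prescribed value is 0 and equals its
        -- negative.
        on (yes -v∈vs) _ with ≡.refl ← unpaired (v∈vs , -v∈vs) =
          trans (-‿cong parabola-top) (trans -0#≈0# (sym parabola-top))
        on (no _) (yes _)   = solve 1 (λ x → :- (:- x) := x) refl d
        on (no _) (no v∉vs) = contradiction v∈vs v∉vs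

      -- The value is - d if the antipode is on the path and 0 otherwise, and d ≤ 0 because 0 <
      -- φ(eᵢ) ≤ A.
      ψᵛ-off-path : ∀ {v} → v ∉ vs → 0# ≤ ψᵛ v
      ψᵛ-off-path {s , i} = off s
        where
        d = parabola (φᵛ (Sign.+ , i))
        d≤0 : d ≤ 0#
        d≤0 = parabola-≤0 (<-respʳ-≈ (sym (φe≈a i)) (0<a i))
          (≤-respˡ-≈ (sym (φe≈a i)) (≤-respʳ-≈ (sym (φe≈a (fromℕ N))) (a-mono-≤ (Fin.≤fromℕ i))))
        0≤-d : 0# ≤ - d
        0≤-d = ≤-respʳ-≈ (+-identityˡ (- d)) (≤⇒0≤- d≤0)
        pos : ∀ {P Q} (p? : Dec P) (q? : Dec Q) → ¬ P → 0# ≤ d if p? else-if q?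
        pos (yes p) _       ¬p = contradiction p ¬p
        pos (no _)  (yes _) _  = 0≤-d
        pos (no _)  (no _)  _  = ≤-refl
        neg : ∀ {P Q} (p? : Dec P) (q? : Dec Q) → ¬ Q → 0# ≤ - (d if p? else-if q?)
        neg (yes _) _       _  = 0≤-d
        neg (no _)  (yes q) ¬q = contradiction q ¬q
        neg (no _)  (no _)  _  = inj₂ (sym -0#≈0#)
        off : ∀ s → (s , i) ∉ vs → 0# ≤ ψᵛ (s , i)
        off Sign.+ v∉vs = ≤-respʳ-≈ (sym (functional-e lift i)) (pos ((Sign.+ , i) ∈? vs) ((Sign.- , i) ∈? vs) v∉vs)
        off Sign.- v∉vs = ≤-respʳ-≈ (sym (ψᵛ-neg i)) (neg ((Sign.+ , i) ∈? vs) ((Sign.- , i) ∈? vs) v∉vs)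

      ≤A : ∀ v → φᵛ v ≤ A
      ≤A v = [ (λ { ≡.refl → ≤-refl }) , inj₁ ]′ (top-or-≺top v)

      -A≤ : ∀ v → - A ≤ φᵛ v
      -A≤ v = ≤-respˡ-≈ (linear-antipode φ top) ([ (λ { ≡.refl → ≤-refl }) , inj₁ ]′ (bot-or-bot≺ v))

      <A : ∀ {v} → v ∉ vs → φᵛ v < A
      <A {v} v∉vs = [ (λ { ≡.refl → contradiction top∈ v∉vs }) , id ]′ (top-or-≺top v)

      -A< : ∀ {v} → v ∉ vs → - A < φᵛ v
      -A< {v} v∉vs = <-respˡ-≈ (linear-antipode φ top)
        ([ (λ { ≡.refl → contradiction bot∈ v∉vs }) , id ]′ (bot-or-bot≺ v))

      height-path : ∀ {v} s → v ∈ vs → height s (image v) ≈ parabola (φᵛ v) - s * φᵛ v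
      height-path s v∈vs = +-congʳ (ψᵛ-path v∈vs)

      -- The slope of the chord of the parabola over φ(v) and φ(w), or of the tangent if v = w.
      secant : Vertex n → Vertex n → Carrier
      secant v w = φᵛ v + φᵛ w

      secant-height : ∀ {v w} → v ∈ vs → w ∈ vs → height (secant v w) (image v) ≈ height (secant v w) (image w)
      secant-height v∈vs w∈vs =
        trans (height-path _ v∈vs) (trans (secant-at-ends _ _) (sym (height-path _ w∈vs)))

      -- Path vertices `u` lie on the parabola outside the chord, the others in the strip on or
      -- above the axis. A slope of 0 would make `v` the antipode of `w`. The case v = w yields the
      -- lower vertices, consecutive `v` and `w` the lower edges.
      below-others : ∀ {v w} → v ∈ vs → v ≢ antipode w → φᵛ v ≤ φᵛ w →
        (∀ {u} → u ∈ vs → ¬ (v ≺ u × u ≺ w)) →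
        ∀ u → u ≢ v → u ≢ w → height (secant v w) (image v) < height (secant v w) (image u)
      below-others {v} {w} v∈vs v≢-w v≤w nothing-between u u≢v u≢w with u ∈? vs
      ... | yes u∈vs = <-respˡ-≈ (sym (height-path _ v∈vs)) (<-respʳ-≈ (sym (height-path _ u∈vs))
              (secant-below-parabola v≤w outside))
        where
        outside : u ≺ v ⊎ w ≺ u
        outside with compare (φᵛ u) (φᵛ v) | compare (φᵛ w) (φᵛ u)
        ... | tri< u≺v _ _ | _            = inj₁ u≺v
        ... | tri≈ _ u≈v _ | _            = contradiction (φᵛ-injective u v u≈v) u≢v
        ... | tri> _ _ _   | tri< w≺u _ _ = inj₂ w≺u
        ... | tri> _ _ _   | tri≈ _ w≈u _ = contradiction (φᵛ-injective u w (sym w≈u)) u≢w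
        ... | tri> _ _ v≺u | tri> _ _ u≺w = contradiction (v≺u , u≺w) (nothing-between u∈vs)
      ... | no u∉vs = <-respˡ-≈ (sym (height-path _ v∈vs))
              (secant-below-strip v+w≉0 (-A≤ v) (≤A v) (-A≤ w) (≤A w) (-A< u∉vs) (<A u∉vs) (ψᵛ-off-path u∉vs))
        where
        v+w≉0 : ¬ φᵛ v + φᵛ w ≈ 0#
        v+w≉0 eq = v≢-w (φᵛ-injective v (antipode w) (begin
          φᵛ v                          ≈⟨ solve 2 (λ v w → v := v :+ w :- w) refl (φᵛ v) (φᵛ w) ⟩
          φᵛ v + φᵛ w - φᵛ w            ≈⟨ +-congʳ eq ⟩
          0# - φᵛ w                     ≈⟨ +-identityˡ _ ⟩
          - φᵛ w                        ≈⟨ linear-antipode φ w ⟨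
          φᵛ (antipode w)               ∎))

      path⇒lowerVertex : ∀ {p} → Any (λ v → image v ≈₂ p) vs → LowerVertex (shadow φ ψ) p
      path⇒lowerVertex image≈p =
        let v , v∈vs , v≈p = find image≈p
        in lowerVertex-resp-≈ v≈p (strictlyLowest⇒lowerVertex v λ u u≢v →
             below-others v∈vs (λ v≡-v → Sign.s≢opposite[s] _ (≡.cong proj₁ v≡-v)) ≤-refl
               (λ _ (v≺u , u≺v) → <-asym v≺u u≺v) u u≢v u≢v)

      -- For the slope `s` of the given lower vertex, the lowest path vertex is lowest among all
      -- vertices, as each vertex off the path is no lower than one of the two ends. Uniqueness then
      -- identifies its image with `p`.
      lowerVertex⇒path : ∀ {p} → LowerVertex (shadow φ ψ) p → Any (λ v → image v ≈₂ p) vs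
      lowerVertex⇒path {p} p-lower@(s , _) = lose v∈vs (lowest⇒lowerVertex-≈ v p-lower lowest)
        where
        h = height s ∘ image
        v = argmin ≤-totalOrder h bot vs
        v∈vs : v ∈ vs
        v∈vs = argmin-all ≤-totalOrder h bot∈ (All.tabulate id)
        path-lowest : ∀ {u} → u ∈ vs → h v ≤ h u
        path-lowest = All.lookup (f[argmin]≤f[xs] ≤-totalOrder bot vs)
        lowest : Lowest s v
        lowest u with u ∈? vs
        ... | yes u∈vs = path-lowest u∈vs
        ... | no  u∉vs with end-below-strip (-A< u∉vs) (<A u∉vs) (ψᵛ-off-path u∉vs)
        ...   | inj₁ top≤u = ≤-trans (path-lowest top∈) (≤-respˡ-≈ (sym (height-path s top∈)) top≤u)
        ...   | inj₂ bot≤u = ≤-trans (path-lowest bot∈) (≤-respˡ-≈ (sym (trans (height-path s bot∈)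
                (+-cong (+-congʳ (*-cong -A -A)) (-‿cong (*-congˡ -A))))) bot≤u)
          where
          -A : φᵛ bot ≈ - A
          -A = linear-antipode φ top

      consecutive⇒lowerEdge : ∀ {v w} → Consecutive vs v w → ∃[ s ] LowerEdge (shadow φ ψ) s ×
        (∀ x → segment v w x ⇔ (◇ n x × LowerFace (shadow φ ψ) s (projection φ ψ x)))
      consecutive⇒lowerEdge {v} {w} cons@(v∈vs , w∈vs , v≺w , nothing-between) =
        secant v w , lowest-pair⇒lowerEdge v w (secant-height v∈vs w∈vs) v≺w
          (below-others v∈vs (proj₁ (consecutive⇒step sep cons)) (inj₁ v≺w) nothing-between)

  -- The bound n - 2 and its attainment

  module ExtremalPath {M : ℕ} (φ : LinearFunctional (suc (suc M))) (a : Vector Carrier (suc (suc M)))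
    (φe≈a : ∀ i → ⟦ φ ⟧ (e i) ≈ a i) (0<a : ∀ i → 0# < a i) (a-mono : ∀ i j → i Fin.< j → a i < a j) where
    open MonotonePaths φ a φe≈a 0<a a-mono

    extremalPath-separated : Separated (extremalPath n)
    extremalPath-separated = record
      { sorted    = AllPairs.++⁺
          (AllPairs.map⁺ (AllPairs-reverse (AllPairs.tabulate⁺-< {f = id} λ {i} {j} i<j → neg≺neg j i i<j)))
          (AllPairs.map⁺ (AllPairs.tabulate⁺-< {f = suc} λ {i} {j} i<j → pos≺pos (suc i) (suc j) (s≤s i<j)))
          (All.map⁺ (All.universal (λ i → All.map⁺ (All.universal (neg≺pos i) _)) _))
      ; bot∈      = neg∈extremalPath (fromℕ (suc M))
      ; top∈      = pos∈extremalPath (fromℕ M)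
      -- -e₁ has the least possible index, and it separates all pairs since e₁ is not on the path.
      ; pivot     = Sign.- , zero
      ; pivot∈    = neg∈extremalPath zero
      ; separates = λ { {zero} (_ , e₁∈) → contradiction e₁∈ +e₁∉extremalPath ; {suc i} _ → z<s }
      }

    walk-to-coherent : ∀ {vs} → MonotonePath φ vs →
      ∃[ ws ] Coherent φ ws × (Σ (Walk φ vs ws) λ w → walkLength w ℕ.≤ M)
    walk-to-coherent path =
      -- Every index but the last is below M + 1, so this bound fits any path and gives length at
      -- most (M + 1) ∸ 1 = M = n - 2.
      let ws , sep , unpaired , w , w≤ = walk-to-unpaired (suc M) ℕ.≤-refl (monotone⇒separated path) (λ {i} _ → bound i)
      in ws , unpaired⇒coherent sep unpaired , w , w≤
      where
      bound : ∀ i → i ≡ fromℕ (suc M) ⊎ toℕ i ℕ.< suc M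
      bound i with i Fin.≟ fromℕ (suc M)
      ... | yes i≡last = inj₁ i≡last
      ... | no  i≢last = inj₂ (ℕ.<-≤-trans (Fin.≤∧≢⇒< (Fin.≤fromℕ i) i≢last) (ℕ.≤-reflexive (Fin.toℕ-fromℕ (suc M))))

    extremalPath-distance : ∀ ws → Coherent φ ws → (w : Walk φ (extremalPath n) ws) → M ℕ.≤ walkLength w
    extremalPath-distance ws coherent w = ≡.subst (ℕ._≤ walkLength w) (List.length-tabulate {n = M} (suc ∘ inject₁))
      (pairs≤walkLength w (coherent⇒unpaired coherent)
        (innerIndices-unique M) (innerIndices≢last M) (extremalPath-paired M))

    extremalPath-distanceToCoherent : DistanceToCoherent φ (extremalPath n) M
    extremalPath-distanceToCoherent =
      let ws , coherent , w , w≤M = walk-to-coherent (separated⇒monotone extremalPath-separated)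
      in (ws , coherent , w , ℕ.≤-antisym w≤M (extremalPath-distance ws coherent w)) , extremalPath-distance

theorem1p1 : ∀ {c ℓ₁ ℓ₂} (F : OrderedField c ℓ₁ ℓ₂) →
    let open OrderedField F
        open CrossPolytope F
    in
    (n : ℕ) .{{_ : NonZero n}} → 3 ℕ.≤ n →
    (φ : LinearFunctional n) (a : Vector Carrier n) →
    (∀ i → ⟦ φ ⟧ (e i) ≈ a i) →
    (∀ i → 0# < a i) → (∀ i j → i Fin.< j → a i < a j) →
    (∀ vs → MonotonePath φ vs →
      ∃[ ws ] Coherent φ ws × (Σ (Walk φ vs ws) λ w → walkLength w ℕ.≤ n ∸ 2)) ×
    (MonotonePath φ (extremalPath n) ×
      DistanceToCoherent φ (extremalPath n) (n ∸ 2))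
theorem1p1 F (suc (suc M)) (s≤s (s≤s _)) φ a φe≈a 0<a a-mono =
  (λ _ → walk-to-coherent) , separated⇒monotone extremalPath-separated , extremalPath-distanceToCoherent
  where
  open MonotonePaths F φ a φe≈a 0<a a-mono
  open ExtremalPath F φ a φe≈a 0<a a-mono
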